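{- For any positive integers $n$ and $k$ such that $k\le 2^n$, we have $v_2(s(2^n+1,k+1))=v_2(s(2^n,k))$.
   Context: For nonnegative integers $n,k$, the (unsigned) Stirling number of the first kind $s(n,k)$ is defined by $x(x+1)\cdots(x+n-1)=\sum_{k=0}^{n}s(n,k)x^k$, with $s(n,k)=0$ for $k>n$. $v_2$ denotes the 2-adic valuation. -}

module Defs where

open import Data.Nat using (ℕ; zero; suc; _+_; _*_; _<_; s≤s; z≤n)
open import Data.Nat.DivMod using (_/_; _%_; m/n<m)
open import Data.Nat.Induction using (<-rec)
open import Data.Nat.Properties using (_≟_)
open import Relation.Nullary using (yes; no)

-- Unsigned Stirling numbers of the first kind:
-- x(x+1)...(x+n-1) = Σ_k s(n,k) x^k.  Multiplying by (x+n) gives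
-- s(n+1,k+1) = n * s(n,k+1) + s(n,k).
stirling1 : ℕ → ℕ → ℕ
stirling1 zero    zero    = 1
stirling1 zero    (suc k) = 0
stirling1 (suc n) zero    = 0
stirling1 (suc n) (suc k) = n * stirling1 n (suc k) + stirling1 n k

-- 2-adic valuation of a natural number (largest e with 2^e ∣ m);
-- convention v₂ 0 = 0 (never used here: the relevant values are nonzero).
v₂ : ℕ → ℕ
v₂ = <-rec _ step
  where
  step : (m : ℕ) → ({j : ℕ} → j < m → ℕ) → ℕ
  step zero    rec = 0
  step (suc m) rec with (suc m) % 2 ≟ 0
  ... | yes _ = suc (rec {suc m / 2} (m/n<m (suc m) 2 (s≤s (s≤s z≤n))))
  ... | no  _ = 0

{-# OPTIONS --safe #-}
-- Write n = m + 1, M = 2^m, and let P and R be the rising factorials of lengths 2M and 2M + 1, so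
-- that R = (x + 2M) P, i.e. P_k = R_{k+1} - 2^n P_{k+1}.  By downward induction on k it suffices
-- that v(R_k) < n + v(R_{k+1}) for k ≥ 2.  Centring R at -M gives R = Σ_j H_j (x + M)^{2j+1}, where
-- H = ∏_{i=1}^{M} (z - i²), and the first nonzero summand dominates: with h_j = v(H_j),
--   v(R_{2j+1}) = h_j   and   v(R_{2j}) = m + h_j   for j ≥ 1,
-- provided h_j < 2m + h_{j+1}.
--
-- The h_j are found by recursion on m.  Separating odd and even i, H for m + 1 is O(z) · 4^M H(z/4)
-- with O ≡ (z - 1)^M mod 2^(m+1), so that v(O_b) = m - v(b).  In the product one term dominates each
-- coefficient: its valuation is v(O_b) at index M + b, and 2(M - i) + h_i at index i ≤ M.
module Submission where

open import Defs

module StirlingValuation where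

  open import Data.Nat.Base as ℕ using (ℕ; zero; suc; z≤n; s≤s)
  import Data.Nat.Properties as ℕ
  import Data.Nat.DivMod as ℕ
  import Data.Nat.Divisibility as ℕ
  open import Data.Nat.Induction using (<-rec; <-wellFounded)
  import Data.Nat.Tactic.RingSolver as ℕ-solver
  open import Data.Integer.Base using (ℤ; +_; -[1+_]; ∣_∣; _+_; _*_; _-_; -_; 0ℤ; 1ℤ)
  import Data.Integer.Properties as ℤ
  open import Data.Integer.Divisibility.Signed
  open import Data.Integer.Tactic.RingSolver using (solve-∀)
  open import Data.Product using (∃-syntax; _×_; _,_; proj₁; proj₂)
  open import Data.Sum using (_⊎_; inj₁; inj₂)
  open import Function using (_∘_)
  open import Induction.WellFounded using (module FixPoint; module Some; acc-inverse)
  open import Relation.Binary.Definitions using (tri<; tri≈; tri>)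
  open import Relation.Binary.PropositionalEquality
  open import Relation.Nullary using (yes; no; contradiction)
  import Algebra.Properties.CommutativeSemigroup ℕ.+-commutativeSemigroup as ℕ+

  -- 2-adic valuation

  mutual
    v₂-step : (m : ℕ) → (∀ {j} → j ℕ.< m → ℕ) → ℕ
    v₂-step = _

    -- The recursion step of v₂ is local to Defs.  After two halvings v₂ reduces to a term that is
    -- stuck on a variable accessibility proof, where unification can read the step off.
    v₂-step-determined : ∀ m → v₂ (suc m) ≡ v₂ (suc m)
    v₂-step-determined m with suc m ℕ.% 2 ℕ.≟ 0
    ... | no _ = refl
    ... | yes _ with suc m ℕ./ 2 | ℕ.m/n<m (suc m) 2 (s≤s (s≤s z≤n))
    ...   | zero  | _ = refl
    ...   | suc j | j<m with suc j ℕ.% 2 ℕ.≟ 0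
    ...     | no _  = refl
    ...     | yes _ = cong (suc ∘ suc) (refl {x = Some.wfRecBuilder (λ _ → ℕ) v₂-step (suc j)
                        (acc-inverse (<-wellFounded (suc m)) j<m) (ℕ.m/n<m (suc j) 2 (s≤s (s≤s z≤n)))})

  -- Extensionality of the step is what `unfold-wfRec` asks for; it makes the result independent of
  -- the accessibility proof.
  v₂-step-ext : ∀ m {f g : ∀ {j} → j ℕ.< m → ℕ} → (∀ {j} (j<m : j ℕ.< m) → f j<m ≡ g j<m) →
                v₂-step m f ≡ v₂-step m g
  v₂-step-ext zero    f≗g = refl
  v₂-step-ext (suc m) f≗g with suc m ℕ.% 2 ℕ.≟ 0
  ... | yes _ = cong suc (f≗g _)
  ... | no  _ = refl

  v₂-unfold : ∀ m → v₂ m ≡ v₂-step m (λ {j} _ → v₂ j)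
  v₂-unfold m = FixPoint.unfold-wfRec <-wellFounded (λ _ → ℕ) v₂-step v₂-step-ext {m}

  v₂-even : ∀ m → suc m ℕ.% 2 ≡ 0 → v₂ (suc m) ≡ suc (v₂ (suc m ℕ./ 2))
  v₂-even m even = trans (v₂-unfold (suc m)) step≡
    where
    step≡ : v₂-step (suc m) (λ {j} _ → v₂ j) ≡ suc (v₂ (suc m ℕ./ 2))
    step≡ with suc m ℕ.% 2 ℕ.≟ 0
    ... | yes _   = refl
    ... | no ¬even = contradiction even ¬even

  v₂-odd : ∀ m → suc m ℕ.% 2 ≢ 0 → v₂ (suc m) ≡ 0
  v₂-odd m ¬even = trans (v₂-unfold (suc m)) step≡
    where
    step≡ : v₂-step (suc m) (λ {j} _ → v₂ j) ≡ 0
    step≡ with suc m ℕ.% 2 ℕ.≟ 0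
    ... | yes even = contradiction even ¬even
    ... | no _    = refl

  v₂[2*m] : ∀ m .{{_ : ℕ.NonZero m}} → v₂ (2 ℕ.* m) ≡ suc (v₂ m)
  v₂[2*m] m@(suc _) = trans (v₂-even _ (ℕ.n∣m⇒m%n≡0 (2 ℕ.* m) 2 (ℕ.m∣m*n m)))
                            (cong (suc ∘ v₂) (trans (cong (ℕ._/ 2) (ℕ.*-comm 2 m)) (ℕ.m*n/n≡m m 2)))

  v₂[1+2*m] : ∀ m → v₂ (1 ℕ.+ 2 ℕ.* m) ≡ 0
  v₂[1+2*m] m = v₂-odd (2 ℕ.* m) λ even →
    contradiction (trans (sym (trans (cong (λ k → suc k ℕ.% 2) (ℕ.*-comm 2 m)) (ℕ.[m+kn]%n≡m%n 1 m 2))) even) λ ()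

  v₂[2^e*odd] : ∀ e m → v₂ (2 ℕ.^ e ℕ.* (1 ℕ.+ 2 ℕ.* m)) ≡ e
  v₂[2^e*odd] zero    m = trans (cong v₂ (ℕ.+-identityʳ _)) (v₂[1+2*m] m)
  v₂[2^e*odd] (suc e) m = begin
    v₂ (2 ℕ.* 2 ℕ.^ e ℕ.* (1 ℕ.+ 2 ℕ.* m))   ≡⟨ cong v₂ (ℕ.*-assoc 2 (2 ℕ.^ e) _) ⟩
    v₂ (2 ℕ.* (2 ℕ.^ e ℕ.* (1 ℕ.+ 2 ℕ.* m))) ≡⟨ v₂[2*m] _ {{ℕ.m*n≢0 (2 ℕ.^ e) _ {{ℕ.m^n≢0 2 e}}}} ⟩
    suc (v₂ (2 ℕ.^ e ℕ.* (1 ℕ.+ 2 ℕ.* m)))   ≡⟨ cong suc (v₂[2^e*odd] e m) ⟩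
    suc e                                    ∎
    where open ≡-Reasoning

  -- Powers of 2 and exact valuations of integers

  pow2 : ℕ → ℤ
  pow2 e = + (2 ℕ.^ e)

  pow2-suc : ∀ e → pow2 (suc e) ≡ + 2 * pow2 e
  pow2-suc e = ℤ.pos-* 2 (2 ℕ.^ e)

  pow2-+ : ∀ a b → pow2 (a ℕ.+ b) ≡ pow2 a * pow2 b
  pow2-+ a b = trans (cong +_ (ℕ.^-distribˡ-+-* 2 a b)) (ℤ.pos-* (2 ℕ.^ a) (2 ℕ.^ b))

  pow2-∣-+ : ∀ a b {x} → pow2 b ∣ x → pow2 (a ℕ.+ b) ∣ pow2 a * x
  pow2-∣-+ a b {x} d = subst (_∣ pow2 a * x) (sym (pow2-+ a b)) (*-monoʳ-∣ (pow2 a) d)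

  pow2-∣ : ∀ {a b} → a ℕ.≤ b → pow2 a ∣ pow2 b
  pow2-∣ {a} a≤b with ℕ.m≤n⇒∃[o]m+o≡n a≤b
  ... | c , refl = subst (pow2 a ∣_) (sym (pow2-+ a c)) (∣m⇒∣m*n (pow2 c) ∣-refl)

  pow2-0-∣ : ∀ x → pow2 0 ∣ x
  pow2-0-∣ x = divides x (sym (ℤ.*-identityʳ x))

  _∣0 : ∀ d → d ∣ 0ℤ
  d ∣0 = divides 0ℤ refl

  ∣-via : ∀ {d x y} → x ≡ y → d ∣ y → d ∣ x
  ∣-via eq = subst (_ ∣_) (sym eq)

  ∣*∣ : ∀ {a b x y} → a ∣ x → b ∣ y → a * b ∣ x * y
  ∣*∣ {a} {b} {x} {y} a∣x b∣y = ∣-trans (*-monoʳ-∣ a b∣y) (*-monoˡ-∣ y a∣x)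

  pow2-∣-* : ∀ a b {x y} → pow2 a ∣ x → pow2 b ∣ y → pow2 (a ℕ.+ b) ∣ x * y
  pow2-∣-* a b {x} {y} p q = subst (_∣ x * y) (sym (pow2-+ a b)) (∣*∣ p q)

  -- The odd cofactor is kept as a witness, so the valuation is exact and x is nonzero.
  record Val (e : ℕ) (x : ℤ) : Set where
    constructor _,_
    field
      half : ℤ
      eq   : x ≡ pow2 e * (1ℤ + + 2 * half)

  -- A change divisible by 2^(e+1) alters the odd cofactor by an even amount. This is how a dominant
  -- term determines the valuation of a sum.
  Val-resp-∣ : ∀ {e x y} → Val e x → pow2 (suc e) ∣ y - x → Val e y
  Val-resp-∣ {e} {x} {y} (u , x≡) (divides q y-x≡) = u + q , (begin
    y                                                         ≡⟨ split y x ⟩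
    x + (y - x)                                               ≡⟨ cong₂ _+_ x≡ (trans y-x≡ (cong (q *_) (pow2-suc e))) ⟩
    pow2 e * (1ℤ + + 2 * u) + q * (+ 2 * pow2 e)              ≡⟨ collect (pow2 e) u q ⟩
    pow2 e * (1ℤ + + 2 * (u + q))                             ∎)
    where
    open ≡-Reasoning
    split : ∀ y x → y ≡ x + (y - x)
    split = solve-∀
    collect : ∀ p u q → p * (1ℤ + + 2 * u) + q * (+ 2 * p) ≡ p * (1ℤ + + 2 * (u + q))
    collect = solve-∀

  Val-* : ∀ {e f x y} → Val e x → Val f y → Val (e ℕ.+ f) (x * y)
  Val-* {e} {f} (u , refl) (w , refl) = u + w + + 2 * (u * w) ,
    trans (collect (pow2 e) (pow2 f) u w) (cong (_* _) (sym (pow2-+ e f)))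
    where
    collect : ∀ p q u w → p * (1ℤ + + 2 * u) * (q * (1ℤ + + 2 * w)) ≡
                          p * q * (1ℤ + + 2 * (u + w + + 2 * (u * w)))
    collect = solve-∀

  Val-pow2 : ∀ e → Val e (pow2 e)
  Val-pow2 e = 0ℤ , sym (ℤ.*-identityʳ (pow2 e))

  Val⇒∣ : ∀ {e f x} → Val e x → f ℕ.≤ e → pow2 f ∣ x
  Val⇒∣ (u , refl) f≤e = ∣m⇒∣m*n (1ℤ + + 2 * u) (pow2-∣ f≤e)

  -- Induction on s: x differs from (1 + 2u)x by an even number, so x = 2y, and cancelling 2 leaves
  -- the same hypothesis on y with exponent one less.
  odd-cancel-∣ : ∀ u s {x} → pow2 s ∣ (1ℤ + + 2 * u) * x → pow2 s ∣ x
  odd-cancel-∣ u zero    {x} _ = pow2-0-∣ x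
  odd-cancel-∣ u (suc s) {x} (divides q eq) =
    subst₂ _∣_ (sym (pow2-suc s)) (sym x≡2y) (*-monoʳ-∣ (+ 2) (odd-cancel-∣ u s (divides q odd*y≡)))
    where
    open ≡-Reasoning
    y = q * pow2 s - u * x
    isolate : ∀ u x z → (1ℤ + + 2 * u) * x ≡ z → x ≡ z - + 2 * (u * x)
    isolate u x z refl = lem u x
      where
      lem : ∀ u x → x ≡ (1ℤ + + 2 * u) * x - + 2 * (u * x)
      lem = solve-∀
    factor : ∀ q p c → q * (+ 2 * p) - + 2 * c ≡ + 2 * (q * p - c)
    factor = solve-∀
    eq′ : (1ℤ + + 2 * u) * x ≡ q * (+ 2 * pow2 s)
    eq′ = trans eq (cong (q *_) (pow2-suc s))
    x≡2y : x ≡ + 2 * y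
    x≡2y = trans (isolate u x _ eq′) (factor q (pow2 s) (u * x))
    swap : ∀ a b → + 2 * (a * b) ≡ a * (+ 2 * b)
    swap = solve-∀
    odd*y≡ : (1ℤ + + 2 * u) * y ≡ q * pow2 s
    odd*y≡ = ℤ.*-cancelˡ-≡ (+ 2) _ _ (begin
      + 2 * ((1ℤ + + 2 * u) * y) ≡⟨ swap (1ℤ + + 2 * u) y ⟩
      (1ℤ + + 2 * u) * (+ 2 * y) ≡⟨ cong ((1ℤ + + 2 * u) *_) x≡2y ⟨
      (1ℤ + + 2 * u) * x         ≡⟨ eq′ ⟩
      q * (+ 2 * pow2 s)         ≡⟨ swap q (pow2 s) ⟨
      + 2 * (q * pow2 s)         ∎)

  pow2-cancel-∣ : ∀ t s {x} → pow2 (t ℕ.+ s) ∣ pow2 t * x → pow2 s ∣ x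
  pow2-cancel-∣ t s {x} d =
    *-cancelˡ-∣ (pow2 t) {{ℕ.m^n≢0 2 t}} (subst (_∣ pow2 t * x) (pow2-+ t s) d)

  Val-cancel-∣ : ∀ t s {b x} → Val t b → pow2 (t ℕ.+ s) ∣ b * x → pow2 s ∣ x
  Val-cancel-∣ t s {x = x} (u , refl) d =
    odd-cancel-∣ u s (pow2-cancel-∣ t s (subst (_ ∣_) (ℤ.*-assoc (pow2 t) (1ℤ + + 2 * u) x) d))

  -- Divisibility comes first, so that x = y 2^e; what remains is (1 + 2u) y = 1 + 2w, which forces
  -- y to be odd.
  Val-cancel : ∀ t e {b x} → Val t b → Val (t ℕ.+ e) (b * x) → Val e x
  Val-cancel t e {b} {x} vb@(u , refl) vbx@(w , eq)
    with divides y refl ← Val-cancel-∣ t e {b} {x} vb (Val⇒∣ {x = b * x} vbx ℕ.≤-refl)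
    = w - u * y , trans (ℤ.*-comm y (pow2 e)) (cong (pow2 e *_) (isolate u y w odd*y≡))
    where
    isolate : ∀ u y w → (1ℤ + + 2 * u) * y ≡ 1ℤ + + 2 * w → y ≡ 1ℤ + + 2 * (w - u * y)
    isolate u y w eq = trans (lem₁ u y) (trans (cong (_- + 2 * (u * y)) eq) (lem₂ w (u * y)))
      where
      lem₁ : ∀ u y → y ≡ (1ℤ + + 2 * u) * y - + 2 * (u * y)
      lem₁ = solve-∀
      lem₂ : ∀ w c → 1ℤ + + 2 * w - + 2 * c ≡ 1ℤ + + 2 * (w - c)
      lem₂ = solve-∀
    regroup : ∀ p q o y → p * q * (o * y) ≡ p * o * (y * q)
    regroup = solve-∀
    odd*y≡ : (1ℤ + + 2 * u) * y ≡ 1ℤ + + 2 * w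
    odd*y≡ = ℤ.*-cancelˡ-≡ (pow2 (t ℕ.+ e)) _ _ {{ℕ.m^n≢0 2 (t ℕ.+ e)}}
      (trans (trans (cong (_* ((1ℤ + + 2 * u) * y)) (pow2-+ t e)) (regroup (pow2 t) (pow2 e) (1ℤ + + 2 * u) y)) eq)

  ∣1+2*∣ : ∀ u → ∃[ w ] ∣ 1ℤ + + 2 * u ∣ ≡ 1 ℕ.+ 2 ℕ.* w
  ∣1+2*∣ (+ n)      = n , cong (λ z → ∣ 1ℤ + z ∣) (sym (ℤ.pos-* 2 n))
  -- 1 - 2(n + 1) = -(2n + 1), so the half of the absolute value is n again.
  ∣1+2*∣ (-[1+ n ]) rewrite ℕ.+-suc n (n ℕ.+ 0) = n , refl

  v₂-Val : ∀ {e x} → Val e x → v₂ ∣ x ∣ ≡ e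
  v₂-Val {e} (u , refl) with ∣1+2*∣ u
  ... | w , eq = trans (cong v₂ (trans (ℤ.abs-* (pow2 e) (1ℤ + + 2 * u)) (cong (2 ℕ.^ e ℕ.*_) eq))) (v₂[2^e*odd] e w)

  -- Repeated halving. The bound `2 ^ t ≤ b` lets the valuation t be compared with m when b is at
  -- most 2^m, and with b itself.
  Val-exists : ∀ b → 1 ℕ.≤ b → ∃[ t ] 2 ℕ.^ t ℕ.≤ b × Val t (+ b)
  Val-exists = <-rec _ go
    where
    go : ∀ b → (∀ {c} → c ℕ.< b → 1 ℕ.≤ c → ∃[ t ] 2 ℕ.^ t ℕ.≤ c × Val t (+ c)) →
         1 ℕ.≤ b → ∃[ t ] 2 ℕ.^ t ℕ.≤ b × Val t (+ b)
    go b@(suc b′) rec 1≤b with b ℕ.% 2 in r | b ℕ./ 2 in q | ℕ.m≡m%n+[m/n]*n b 2 | ℕ.m%n<n b 2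
    ... | suc (suc _) | _ | _ | s≤s (s≤s ())
    ... | 1 | c | b≡ | _ = 0 , 1≤b , + c ,
      trans (cong +_ (trans b≡ (cong suc (ℕ.*-comm c 2)))) (trans (cong (_+_ 1ℤ) (ℤ.pos-* 2 c)) (sym (ℤ.*-identityˡ _)))
    ... | 0 | c@(suc _) | b≡ | _ with rec {c} (subst (ℕ._< b) q (ℕ.m/n<m b 2 (s≤s (s≤s z≤n)))) (s≤s z≤n)
    ...   | t , 2^t≤c , vc = suc t
          , subst (2 ℕ.^ suc t ℕ.≤_) (sym b≡2c) (ℕ.*-monoʳ-≤ 2 2^t≤c)
          , subst (Val (suc t)) (trans (sym (ℤ.pos-* 2 c)) (cong +_ (sym b≡2c))) (Val-* (Val-pow2 1) vc)
      where
      b≡2c : b ≡ 2 ℕ.* c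
      b≡2c = trans b≡ (ℕ.*-comm c 2)

  -- Polynomials as coefficient sequences

  Poly : Set
  Poly = ℕ → ℤ

  one : Poly
  one zero    = 1ℤ
  one (suc _) = 0ℤ

  tail : Poly → Poly
  tail f k = f (suc k)

  -- (x + a) · f
  lin : ℤ → Poly → Poly
  lin a f zero    = a * f zero
  lin a f (suc k) = a * f (suc k) + f k

  conv : Poly → Poly → Poly
  conv f g zero    = f 0 * g 0
  conv f g (suc k) = f 0 * g (suc k) + conv (tail f) g k

  -- ∏_{i<N} (x + r i)
  prod : (ℕ → ℤ) → ℕ → Poly
  prod r zero    = one
  prod r (suc N) = lin (r N) (prod r N)

  lin-cong : ∀ {a b f g} → a ≡ b → f ≗ g → lin a f ≗ lin b g
  lin-cong {a} refl f≗g zero    = cong (a *_) (f≗g 0)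
  lin-cong {a} refl f≗g (suc k) = cong₂ (λ x y → a * x + y) (f≗g (suc k)) (f≗g k)

  conv-cong : ∀ {f f′ g g′} → f ≗ f′ → g ≗ g′ → conv f g ≗ conv f′ g′
  conv-cong f≗ g≗ zero    = cong₂ _*_ (f≗ 0) (g≗ 0)
  conv-cong f≗ g≗ (suc k) = cong₂ _+_ (cong₂ _*_ (f≗ 0) (g≗ (suc k))) (conv-cong (f≗ ∘ suc) g≗ k)

  conv-linearˡ : ∀ a f f′ g k → conv (λ i → a * f i + f′ i) g k ≡ a * conv f g k + conv f′ g k
  conv-linearˡ a f f′ g zero    = distrib a (f 0) (f′ 0) (g 0)
    where
    distrib : ∀ a x y z → (a * x + y) * z ≡ a * (x * z) + y * z
    distrib = solve-∀
  conv-linearˡ a f f′ g (suc k) = trans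
    (cong (_+_ ((a * f 0 + f′ 0) * g (suc k))) (conv-linearˡ a (tail f) (tail f′) g k))
    (distrib a (f 0) (f′ 0) (g (suc k)) (conv (tail f) g k) (conv (tail f′) g k))
    where
    distrib : ∀ a x y z c d → (a * x + y) * z + (a * c + d) ≡ a * (x * z + c) + (y * z + d)
    distrib = solve-∀

  -- `conv` peels off the constant term of its first argument; peeling off that of the second as
  -- well is what commutativity rests on.
  conv-sucʳ : ∀ f g k → conv f g (suc k) ≡ conv f (tail g) k + f (suc k) * g 0
  conv-sucʳ f g zero    = refl
  conv-sucʳ f g (suc k) = trans (cong (_+_ (f 0 * g (suc (suc k)))) (conv-sucʳ (tail f) g k))
    (sym (ℤ.+-assoc (f 0 * g (suc (suc k))) (conv (tail f) (tail g) k) (f (suc (suc k)) * g 0)))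

  conv-comm : ∀ f g → conv f g ≗ conv g f
  conv-comm f g zero    = ℤ.*-comm (f 0) (g 0)
  conv-comm f g (suc k) = begin
    f 0 * g (suc k) + conv (tail f) g k ≡⟨ cong₂ _+_ (ℤ.*-comm (f 0) (g (suc k))) (conv-comm (tail f) g k) ⟩
    g (suc k) * f 0 + conv g (tail f) k ≡⟨ ℤ.+-comm (g (suc k) * f 0) (conv g (tail f) k) ⟩
    conv g (tail f) k + g (suc k) * f 0 ≡⟨ conv-sucʳ g f k ⟨
    conv g f (suc k)                    ∎
    where open ≡-Reasoning

  conv-linearʳ : ∀ a f g g′ k → conv f (λ i → a * g i + g′ i) k ≡ a * conv f g k + conv f g′ k
  conv-linearʳ a f g g′ k = trans (conv-comm f _ k) (trans (conv-linearˡ a g g′ f k)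
    (cong₂ (λ x y → a * x + y) (conv-comm g f k) (conv-comm g′ f k)))

  conv-linˡ : ∀ a f g → conv (lin a f) g ≗ lin a (conv f g)
  conv-linˡ a f g zero    = ℤ.*-assoc a (f 0) (g 0)
  conv-linˡ a f g (suc k) = trans
    (cong (_+_ (a * f 0 * g (suc k))) (conv-linearˡ a (tail f) f g k))
    (distrib a (f 0) (g (suc k)) (conv (tail f) g k) (conv f g k))
    where
    distrib : ∀ a x y c d → a * x * y + (a * c + d) ≡ a * (x * y + c) + d
    distrib = solve-∀

  conv-linʳ : ∀ a f g → conv f (lin a g) ≗ lin a (conv f g)
  conv-linʳ a f g k = trans (conv-comm f (lin a g) k)
    (trans (conv-linˡ a g f k) (lin-cong refl (conv-comm g f) k))

  conv-zeroˡ : ∀ g k → conv (λ _ → 0ℤ) g k ≡ 0ℤ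
  conv-zeroˡ g zero    = refl
  conv-zeroˡ g (suc k) = trans (ℤ.+-identityˡ _) (conv-zeroˡ g k)

  conv-oneˡ : ∀ g → conv one g ≗ g
  conv-oneˡ g zero    = ℤ.*-identityˡ (g 0)
  conv-oneˡ g (suc k) = trans (cong₂ _+_ (ℤ.*-identityˡ (g (suc k))) (conv-zeroˡ g k)) (ℤ.+-identityʳ (g (suc k)))

  lin-comm : ∀ a b f → lin a (lin b f) ≗ lin b (lin a f)
  lin-comm a b f zero          = swap a b (f 0)
    where
    swap : ∀ a b x → a * (b * x) ≡ b * (a * x)
    swap = solve-∀
  lin-comm a b f (suc zero)    = swap a b (f 1) (f 0)
    where
    swap : ∀ a b x y → a * (b * x + y) + b * y ≡ b * (a * x + y) + a * y
    swap = solve-∀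
  lin-comm a b f (suc (suc k)) = swap a b (f (suc (suc k))) (f (suc k)) (f k)
    where
    swap : ∀ a b x y z → a * (b * x + y) + (b * y + z) ≡ b * (a * x + y) + (a * y + z)
    swap = solve-∀

  prod-cong : ∀ {r r′} → r ≗ r′ → ∀ N → prod r N ≗ prod r′ N
  prod-cong r≗ zero    k = refl
  prod-cong r≗ (suc N) k = lin-cong (r≗ N) (prod-cong r≗ N) k

  prod-+ : ∀ r M N → prod r (N ℕ.+ M) ≗ conv (prod (λ i → r (i ℕ.+ M)) N) (prod r M)
  prod-+ r M zero    k = sym (conv-oneˡ (prod r M) k)
  prod-+ r M (suc N) k = trans (lin-cong refl (prod-+ r M N) k) (sym (conv-linˡ (r (N ℕ.+ M)) _ (prod r M) k))

  prod-interleave : ∀ r N → prod r (N ℕ.+ N) ≗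
    conv (prod (λ i → r (i ℕ.+ i)) N) (prod (λ i → r (suc (i ℕ.+ i))) N)
  prod-interleave r zero    k = sym (conv-oneˡ one k)
  prod-interleave r (suc N) k = begin
    prod r (suc N ℕ.+ suc N) k              ≡⟨ cong (λ n → prod r (suc n) k) (ℕ.+-suc N N) ⟩
    lin o (lin e (prod r (N ℕ.+ N))) k      ≡⟨ lin-cong refl (lin-cong refl (prod-interleave r N)) k ⟩
    lin o (lin e (conv F G)) k              ≡⟨ lin-cong refl (conv-linˡ e F G) k ⟨
    lin o (conv (lin e F) G) k              ≡⟨ conv-linʳ o (lin e F) G k ⟨
    conv (lin e F) (lin o G) k              ∎
    where
    open ≡-Reasoning
    e = r (N ℕ.+ N)
    o = r (suc (N ℕ.+ N))
    F = prod (λ i → r (i ℕ.+ i)) N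
    G = prod (λ i → r (suc (i ℕ.+ i))) N

  prod-degree : ∀ r {N k} → N ℕ.< k → prod r N k ≡ 0ℤ
  prod-degree r {zero}  {suc k} _         = refl
  prod-degree r {suc N} {suc k} (s≤s N<k) = trans
    (cong₂ (λ x y → r N * x + y) (prod-degree r (ℕ.m<n⇒m<1+n N<k)) (prod-degree r N<k))
    (trans (ℤ.+-identityʳ (r N * 0ℤ)) (ℤ.*-zeroʳ (r N)))

  prod-monic : ∀ r N → prod r N N ≡ 1ℤ
  prod-monic r zero    = refl
  prod-monic r (suc N) = trans
    (cong₂ (λ x y → r N * x + y) (prod-degree r (ℕ.n<1+n N)) (prod-monic r N))
    (cong (_+ 1ℤ) (ℤ.*-zeroʳ (r N)))

  -- Congruences of polynomials and dominant terms of products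

  lin-∣ : ∀ {d a b f g} → d ∣ a - b → (∀ k → d ∣ f k - g k) → ∀ k → d ∣ lin a f k - lin b g k
  lin-∣ {d} {a} {b} {f} {g} da df zero    = ∣-via (expand a b (f 0) (g 0))
    (∣m∣n⇒∣m+n (∣m⇒∣m*n (f 0) da) (∣n⇒∣m*n b (df 0)))
    where
    expand : ∀ a b x y → a * x - b * y ≡ (a - b) * x + b * (x - y)
    expand = solve-∀
  lin-∣ {d} {a} {b} {f} {g} da df (suc k) = ∣-via (expand a b (f (suc k)) (g (suc k)) (f k) (g k))
    (∣m∣n⇒∣m+n (∣m∣n⇒∣m+n (∣m⇒∣m*n (f (suc k)) da) (∣n⇒∣m*n b (df (suc k)))) (df k))
    where
    expand : ∀ a b x y z w → a * x + z - (b * y + w) ≡ (a - b) * x + b * (x - y) + (z - w)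
    expand = solve-∀

  prod-∣ : ∀ {d r r′} → (∀ i → d ∣ r i - r′ i) → ∀ N k → d ∣ prod r N k - prod r′ N k
  prod-∣ {d} dr zero    k = ∣-via (ℤ.+-inverseʳ (one k)) (d ∣0)
  prod-∣     dr (suc N) k = lin-∣ (dr N) (prod-∣ dr N) k

  conv-∣ˡ : ∀ {d f f′} g → (∀ k → d ∣ f k - f′ k) → ∀ k → d ∣ conv f g k - conv f′ g k
  conv-∣ˡ {f = f} {f′} g df zero    = ∣-via (factor (f 0) (f′ 0) (g 0)) (∣m⇒∣m*n (g 0) (df 0))
    where
    factor : ∀ x y z → x * z - y * z ≡ (x - y) * z
    factor = solve-∀
  conv-∣ˡ {f = f} {f′} g df (suc k) =
    ∣-via (factor (f 0) (f′ 0) (g (suc k)) (conv (tail f) g k) (conv (tail f′) g k))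
    (∣m∣n⇒∣m+n (∣m⇒∣m*n (g (suc k)) (df 0)) (conv-∣ˡ g (df ∘ suc) k))
    where
    factor : ∀ x y z c d → x * z + c - (y * z + d) ≡ (x - y) * z + (c - d)
    factor = solve-∀

  -- With f = g + dδ, the difference of squares is 2dδg + d²δ², and d² is a multiple of 2d because d
  -- is even.
  conv-square-∣ : ∀ {d f g} → + 2 ∣ d → (∀ k → d ∣ f k - g k) →
                  ∀ k → + 2 * d ∣ conv f f k - conv g g k
  conv-square-∣ {d} {f} {g} 2∣d df k = ∣-via diff≡
    (∣m∣n⇒∣m+n (∣m⇒∣m*n (conv δ g k) ∣-refl) (∣m⇒∣m*n (conv δ δ k) (*-monoˡ-∣ d 2∣d)))
    where
    open ≡-Reasoning
    δ : Poly
    δ i = quotient (df i)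
    f≗ : ∀ i → f i ≡ d * δ i + g i
    f≗ i = trans (split (f i) (g i)) (cong (_+ g i) (trans (_∣_.equality (df i)) (ℤ.*-comm (δ i) d)))
      where
      split : ∀ x y → x ≡ x - y + y
      split = solve-∀
    collect : ∀ d a b c → d * (d * a + b) + (d * b + c) - c ≡ + 2 * d * b + d * d * a
    collect = solve-∀
    diff≡ : conv f f k - conv g g k ≡ + 2 * d * conv δ g k + d * d * conv δ δ k
    diff≡ = begin
      conv f f k - conv g g k
        ≡⟨ cong (_- conv g g k) (conv-cong f≗ f≗ k) ⟩
      conv (λ i → d * δ i + g i) (λ i → d * δ i + g i) k - conv g g k
        ≡⟨ cong (_- conv g g k) (conv-linearˡ d δ g _ k) ⟩
      d * conv δ (λ i → d * δ i + g i) k + conv g (λ i → d * δ i + g i) k - conv g g k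
        ≡⟨ cong₂ (λ x y → d * x + y - conv g g k) (conv-linearʳ d δ δ g k)
                 (trans (conv-linearʳ d g δ g k) (cong (λ x → d * x + conv g g k) (conv-comm g δ k))) ⟩
      d * (d * conv δ δ k + conv δ g k) + (d * conv δ g k + conv g g k) - conv g g k
        ≡⟨ collect d (conv δ δ k) (conv δ g k) (conv g g k) ⟩
      + 2 * d * conv δ g k + d * d * conv δ δ k ∎

  conv-terms-∣ : ∀ {d} f g k → (∀ a b → a ℕ.+ b ≡ k → d ∣ f a * g b) → d ∣ conv f g k
  conv-terms-∣ f g zero    h = h 0 0 refl
  conv-terms-∣ f g (suc k) h =
    ∣m∣n⇒∣m+n (h 0 (suc k) refl) (conv-terms-∣ (tail f) g k λ a b a+b≡k → h (suc a) b (cong suc a+b≡k))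

  conv-dominant-∣ : ∀ {d} f g i j → (∀ a b → a ℕ.+ b ≡ i ℕ.+ j → a ≢ i → d ∣ f a * g b) →
                    d ∣ conv f g (i ℕ.+ j) - f i * g j
  conv-dominant-∣ {d} f g zero    zero    h = ∣-via (ℤ.+-inverseʳ (f 0 * g 0)) (d ∣0)
  conv-dominant-∣     f g zero    (suc j) h = ∣-via (cancel (f 0 * g (suc j)) _)
    (conv-terms-∣ (tail f) g j λ a b a+b≡j → h (suc a) b (cong suc a+b≡j) λ ())
    where
    cancel : ∀ x y → x + y - x ≡ y
    cancel = solve-∀
  conv-dominant-∣     f g (suc i) j       h = ∣-via (ℤ.+-assoc (f 0 * g (suc (i ℕ.+ j))) (conv (tail f) g (i ℕ.+ j)) _)
    (∣m∣n⇒∣m+n (h 0 (suc (i ℕ.+ j)) refl λ ())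
      (conv-dominant-∣ (tail f) g i j λ a b a+b≡ a≢i → h (suc a) b (cong suc a+b≡) (a≢i ∘ ℕ.suc-injective)))

  -- Products over squares

  -- Coefficient form of the derivative of (x + c)^(N+1), or, up to powers of c, the absorption
  -- identity for binomial coefficients.
  power-absorption : ∀ c N k → + suc k * prod (λ _ → c) (suc N) (suc k) ≡ + suc N * prod (λ _ → c) N k
  power-absorption c zero    zero    = base c
    where
    base : ∀ c → 1ℤ * (c * 0ℤ + 1ℤ) ≡ 1ℤ * 1ℤ
    base = solve-∀
  power-absorption c zero    (suc k) = base c (+ suc (suc k))
    where
    base : ∀ c x → x * (c * 0ℤ + 0ℤ) ≡ 0ℤ
    base = solve-∀
  power-absorption c (suc N) zero    = begin
    1ℤ * (c * P 1 + c * Q 0)       ≡⟨ regroup c (P 1) (Q 0) ⟩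
    c * (1ℤ * P 1) + c * Q 0       ≡⟨ cong (λ x → c * x + c * Q 0) (power-absorption c N 0) ⟩
    c * (+ suc N * Q 0) + c * Q 0  ≡⟨ collect c (+ N) (Q 0) ⟩
    + suc (suc N) * (c * Q 0)      ∎
    where
    open ≡-Reasoning
    P = prod (λ _ → c) (suc N)
    Q = prod (λ _ → c) N
    regroup : ∀ c x y → 1ℤ * (c * x + c * y) ≡ c * (1ℤ * x) + c * y
    regroup = solve-∀
    collect : ∀ c n y → c * ((1ℤ + n) * y) + c * y ≡ (1ℤ + (1ℤ + n)) * (c * y)
    collect = solve-∀
  power-absorption c (suc N) (suc k) = begin
    + suc (suc k) * (c * P (suc (suc k)) + P (suc k))
      ≡⟨ regroup c (+ k) (P (suc (suc k))) (P (suc k)) ⟩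
    c * (+ suc (suc k) * P (suc (suc k))) + (+ suc k * P (suc k) + P (suc k))
      ≡⟨ cong₂ (λ x y → c * x + (y + P (suc k))) (power-absorption c N (suc k)) (power-absorption c N k) ⟩
    c * (+ suc N * Q (suc k)) + (+ suc N * Q k + P (suc k))
      ≡⟨ collect c (+ N) (Q (suc k)) (Q k) ⟩
    + suc (suc N) * P (suc k) ∎
    where
    open ≡-Reasoning
    P = prod (λ _ → c) (suc N)
    Q = prod (λ _ → c) N
    regroup : ∀ c k x y → (1ℤ + (1ℤ + k)) * (c * x + y) ≡ c * ((1ℤ + (1ℤ + k)) * x) + ((1ℤ + k) * y + y)
    regroup = solve-∀
    collect : ∀ c n x y → c * ((1ℤ + n) * x) + ((1ℤ + n) * y + (c * x + y)) ≡ (1ℤ + (1ℤ + n)) * (c * x + y)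
    collect = solve-∀

  -- `B N` is (z - 1)^N, whose coefficients are signed binomial coefficients.
  B : ℕ → Poly
  B = prod (λ _ → - 1ℤ)

  2^m≡suc : ∀ m → ∃[ N ] suc N ≡ 2 ℕ.^ m
  2^m≡suc m with 2 ℕ.^ m | ℕ.m^n>0 2 m
  ... | suc N | _ = N , refl

  2^-cancel-≤ : ∀ a b → 2 ℕ.^ a ℕ.≤ 2 ℕ.^ b → a ℕ.≤ b
  2^-cancel-≤ a b 2^a≤2^b with a ℕ.≤? b
  ... | yes a≤b = a≤b
  ... | no  a≰b = contradiction (ℕ.^-monoʳ-< 2 (s≤s (s≤s z≤n)) (ℕ.≰⇒> a≰b)) (ℕ.≤⇒≯ 2^a≤2^b)

  2^-cancel-< : ∀ a b → 2 ℕ.^ a ℕ.< 2 ℕ.^ b → a ℕ.< b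
  2^-cancel-< a b lt = ℕ.≤∧≢⇒< (2^-cancel-≤ a b (ℕ.<⇒≤ lt)) λ { refl → ℕ.<-irrefl refl lt }

  -- By Pascal's rule adjacent coefficients of (z - 1)^N differ by an inner coefficient of (z -
  -- 1)^(2^m), which is even by absorption. Hence oddness spreads from the constant term.
  B[2^m∸1]-odd : ∀ m {N} → suc N ≡ 2 ℕ.^ m → ∀ k → k ℕ.≤ N → Val 0 (B N k)
  B[2^m∸1]-odd m {N} eq zero    _   = constant-odd N
    where
    constant-odd : ∀ N → Val 0 (B N 0)
    constant-odd zero    = 0ℤ , refl
    constant-odd (suc N) = Val-* {0} {0} { - 1ℤ} (- 1ℤ , refl) (constant-odd N)
  B[2^m∸1]-odd m {N} eq (suc k) k<N = Val-resp-∣ (B[2^m∸1]-odd m eq k (ℕ.<⇒≤ k<N))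
    (∣-via (negate (B N (suc k)) (B N k)) (∣m⇒∣-m even))
    where
    negate : ∀ x y → x - y ≡ - (- 1ℤ * x + y)
    negate = solve-∀
    even : pow2 1 ∣ B (suc N) (suc k)
    even with Val-exists (suc k) (s≤s z≤n)
    ... | t , 2^t≤ , vt with ℕ.m≤n⇒∃[o]m+o≡n (2^-cancel-< t m (ℕ.≤-<-trans 2^t≤ (subst (suc k ℕ.<_) eq (s≤s k<N))))
    ... | s , refl = ∣-trans (pow2-∣ {1} {suc s} (s≤s z≤n)) (Val-cancel-∣ t (suc s) vt
      (∣-via (power-absorption (- 1ℤ) N k) (∣m⇒∣m*n (B N k)
        (∣-via (cong +_ eq) (subst (_∣ pow2 m) (cong pow2 (sym (ℕ.+-suc t s))) ∣-refl)))))

  -- Encodes v(x) = m - v(b) without subtraction, and keeps the valuation of b at hand for later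
  -- cancellation.
  record ValPair (m b : ℕ) (x : ℤ) : Set where
    constructor valPair
    field
      {t e}  : ℕ
      t+e≡m  : t ℕ.+ e ≡ m
      val-b  : Val t (+ b)
      val-x  : Val e x

  -- Absorption turns b B_b into 2^m times a coefficient of (z - 1)^(2^m - 1), which is odd;
  -- cancelling b leaves m - v(b).
  B-val : ∀ m b → 1 ℕ.≤ b → b ℕ.≤ 2 ℕ.^ m → ValPair m b (B (2 ℕ.^ m) b)
  B-val m (suc k) 1≤b b≤ with Val-exists (suc k) 1≤b
  ... | t , 2^t≤b , vb with ℕ.m≤n⇒∃[o]m+o≡n (2^-cancel-≤ t m (ℕ.≤-trans 2^t≤b b≤)) | 2^m≡suc m
  ... | e , refl | N , eq = valPair refl vb (Val-cancel t e vb (subst (Val (t ℕ.+ e)) product≡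
          (subst (λ n → Val n (pow2 m * B N k)) (ℕ.+-identityʳ m)
            (Val-* (Val-pow2 m) (B[2^m∸1]-odd m eq k (ℕ.s≤s⁻¹ (subst (suc k ℕ.≤_) (sym eq) b≤)))))))
    where
    product≡ : pow2 m * B N k ≡ + suc k * B (2 ℕ.^ m) (suc k)
    product≡ = subst (λ n → + n * B N k ≡ + suc k * B n (suc k)) eq (sym (power-absorption (- 1ℤ) N k))

  -- θ stands for z d/dz, which multiplies the coefficient at j by j. This states v(B_j) ≥ m - v(j)
  -- uniformly, including j = 0 and indices beyond the degree.
  θB-∣ : ∀ m j → pow2 m ∣ + j * B (2 ℕ.^ m) j
  θB-∣ m zero    = pow2 m ∣0
  θB-∣ m (suc k) with 2^m≡suc m
  ... | N , eq = subst (λ n → + n ∣ + suc k * B n (suc k)) eq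
                   (∣-via (power-absorption (- 1ℤ) N k) (∣m⇒∣m*n (B N k) ∣-refl))

  -- Splitting the product into odd and even squares

  2^[1+m] : ∀ m → 2 ℕ.^ suc m ≡ 2 ℕ.^ m ℕ.+ 2 ℕ.^ m
  2^[1+m] m = cong (2 ℕ.^ m ℕ.+_) (ℕ.+-identityʳ (2 ℕ.^ m))

  -- H m = ∏_{i=1}^{2^m} (z - i²); O m and E m are the factors of H (suc m) over odd and even i.
  H-root O-root : ℕ → ℤ
  H-root i = - (+ suc i * + suc i)
  O-root i = H-root (i ℕ.+ i)

  H O E : ℕ → Poly
  H m = prod H-root (2 ℕ.^ m)
  O m = prod O-root (2 ℕ.^ m)
  E m = prod (λ i → + 4 * H-root i) (2 ℕ.^ m)

  O-root-periodic : ∀ m i → pow2 (suc (suc m)) ∣ O-root (i ℕ.+ 2 ℕ.^ m) - O-root i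
  O-root-periodic m i = ∣-via (factor (+ i) (pow2 m))
    (∣m⇒∣m*n _ (subst (_∣ + 2 * (+ 2 * pow2 m)) (sym pow2≡) ∣-refl))
    where
    pow2≡ : pow2 (suc (suc m)) ≡ + 2 * (+ 2 * pow2 m)
    pow2≡ = trans (pow2-suc (suc m)) (cong (+ 2 *_) (pow2-suc m))
    factor : ∀ i M → - ((1ℤ + ((i + M) + (i + M))) * (1ℤ + ((i + M) + (i + M)))) - - ((1ℤ + (i + i)) * (1ℤ + (i + i)))
                   ≡ (+ 2 * (+ 2 * M)) * - (1ℤ + + 2 * i + M)
    factor = solve-∀

  -- Modulo 2^(m+2) the roots of O (suc m) are those of O m repeated twice, so O (suc m) ≡ (O m)²,
  -- and squaring the congruence for O m gains a factor 2.
  O≈B : ∀ m k → pow2 (suc m) ∣ O m k - B (2 ℕ.^ m) k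
  O≈B zero    k = ∣-via (ℤ.+-inverseʳ (B 1 k)) (pow2 1 ∣0)
  O≈B (suc m) k = subst (λ n → pow2 (suc (suc m)) ∣ prod O-root n k - B n k) (sym (2^[1+m] m))
    (∣-via (trans (cong₂ _-_ (prod-+ O-root M M k) (prod-+ (λ _ → - 1ℤ) M M k)) (telescope (conv O′ (O m) k) (conv (O m) (O m) k) (conv (B M) (B M) k)))
      (∣m∣n⇒∣m+n
        (conv-∣ˡ {f = O′} {O m} (O m) (prod-∣ {r′ = O-root} (O-root-periodic m) M) k)
        (subst (_∣ conv (O m) (O m) k - conv (B M) (B M) k) (sym (pow2-suc (suc m)))
          (conv-square-∣ (pow2-∣ {1} {suc m} (s≤s z≤n)) (O≈B m) k))))
    where
    M = 2 ℕ.^ m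
    O′ = prod (λ i → O-root (i ℕ.+ M)) M
    telescope : ∀ x y z → x - z ≡ (x - y) + (y - z)
    telescope = solve-∀

  -- The congruence `O≈B` modulo 2^(m+1) preserves valuations up to m, and those of `B` here are m -
  -- v(b).
  O-val : ∀ m b → 1 ℕ.≤ b → b ℕ.≤ 2 ℕ.^ m → ValPair m b (O m b)
  O-val m b 1≤b b≤ with B-val m b 1≤b b≤
  ... | valPair {t} {e} t+e≡m vb vB =
    valPair t+e≡m vb (Val-resp-∣ vB (∣-trans (pow2-∣ (s≤s (subst (e ℕ.≤_) t+e≡m (ℕ.m≤n+m e t)))) (O≈B m b)))

  O₀-odd : ∀ m → Val 0 (O m 0)
  O₀-odd m with 2^m≡suc m
  ... | N , eq = Val-resp-∣ B₀-odd (∣-trans (pow2-∣ {1} {suc m} (s≤s z≤n)) (O≈B m 0))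
    where
    B₀-odd : Val 0 (B (2 ℕ.^ m) 0)
    B₀-odd = subst (λ n → Val 0 (B n 0)) eq (Val-* {0} {0} { - 1ℤ} (- 1ℤ , refl) (B[2^m∸1]-odd m eq 0 z≤n))

  θO-∣ : ∀ m j → pow2 m ∣ + j * O m j
  θO-∣ m j = ∣-via (split (+ j) (O m j) (B (2 ℕ.^ m) j))
    (∣m∣n⇒∣m+n (∣n⇒∣m*n (+ j) (∣-trans (pow2-∣ (ℕ.n≤1+n m)) (O≈B m j))) (θB-∣ m j))
    where
    split : ∀ j x y → j * x ≡ j * (x - y) + j * y
    split = solve-∀

  m<2^m : ∀ m → m ℕ.< 2 ℕ.^ m
  m<2^m zero    = s≤s z≤n
  m<2^m (suc m) = subst (suc m ℕ.<_) (sym (2^[1+m] m)) (ℕ.+-mono-≤ (ℕ.m^n>0 2 m) (m<2^m m))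

  -- v(O_j) ≥ m - v(j) by `θO-∣`, and the factor 4^j makes up the loss with at least one to spare,
  -- since v(j) + 1 ≤ 2j.
  4^j*O-∣ : ∀ m j → 1 ℕ.≤ j → pow2 (suc m) ∣ pow2 (j ℕ.+ j) * O m j
  4^j*O-∣ m j 1≤j with Val-exists j 1≤j
  ... | t , 2^t≤j , (u , j≡) with ℕ.m≤n⇒∃[o]m+o≡n (ℕ.+-mono-≤ 1≤j (ℕ.<⇒≤ (ℕ.<-≤-trans (m<2^m t) 2^t≤j)))
  ... | c , 1+t+c≡2j = ∣-via factor (∣m⇒∣m*n (pow2 c) (pow2-∣-* 1 m {+ 2} ∣-refl
          (odd-cancel-∣ u m (subst (pow2 m ∣_) (trans (cong (_* O m j) j≡) (rotate (pow2 t) _ (O m j))) (θO-∣ m j)))))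
    where
    rotate : ∀ p o x → p * o * x ≡ o * (p * x)
    rotate = solve-∀
    regroup : ∀ p c x → + 2 * p * c * x ≡ + 2 * (p * x) * c
    regroup = solve-∀
    factor : pow2 (j ℕ.+ j) * O m j ≡ + 2 * (pow2 t * O m j) * pow2 c
    factor = trans (cong (_* O m j) (trans (cong pow2 (sym 1+t+c≡2j))
        (trans (pow2-+ (suc t) c) (cong (_* pow2 c) (pow2-suc t)))))
      (regroup (pow2 t) (pow2 c) (O m j))

  -- Positions start at 0 and squares at 1, so the even positions 2i hold (2i + 1)² and the odd ones
  -- hold (2i + 2)² = 4(i + 1)².
  H-split : ∀ m → H (suc m) ≗ conv (O m) (E m)
  H-split m k = trans (cong (λ n → prod H-root n k) (2^[1+m] m))
    (trans (prod-interleave H-root (2 ℕ.^ m) k)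
      (conv-cong (λ _ → refl) (prod-cong (λ i → double (+ i)) (2 ℕ.^ m)) k))
    where
    double : ∀ i → - ((1ℤ + (1ℤ + (i + i))) * (1ℤ + (1ℤ + (i + i)))) ≡ + 4 * - ((1ℤ + i) * (1ℤ + i))
    double = solve-∀

  pow2[2+2d] : ∀ d → pow2 (suc d ℕ.+ suc d) ≡ + 4 * pow2 (d ℕ.+ d)
  pow2[2+2d] d = trans (cong (pow2 ∘ suc) (ℕ.+-suc d d)) (pow2-+ 2 (d ℕ.+ d))

  -- Homogeneity: the coefficient at a is a sum of products of d = N - a of the constants, each of
  -- which is scaled by 4.
  prod-scale : ∀ r {N} a d → a ℕ.+ d ≡ N → prod (λ i → + 4 * r i) N a ≡ pow2 (d ℕ.+ d) * prod r N a
  prod-scale r zero    zero    refl = refl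
  prod-scale r zero    (suc d) refl = trans
    (cong (+ 4 * r d *_) (prod-scale r 0 d refl))
    (trans (regroup (r d) (pow2 (d ℕ.+ d)) (prod r d 0)) (cong (_* (r d * prod r d 0)) (sym (pow2[2+2d] d))))
    where
    regroup : ∀ r p x → + 4 * r * (p * x) ≡ + 4 * p * (r * x)
    regroup = solve-∀
  prod-scale r (suc a) zero    refl rewrite ℕ.+-identityʳ a =
    trans (prod-monic (λ i → + 4 * r i) (suc a)) (sym (trans (ℤ.*-identityˡ _) (prod-monic r (suc a))))
  prod-scale r (suc a) (suc d) refl = trans
    (cong₂ (λ x y → + 4 * r N * x + y) (prod-scale r (suc a) d (sym (ℕ.+-suc a d))) (prod-scale r a (suc d) refl))
    (trans (cong (λ p → + 4 * r N * (pow2 (d ℕ.+ d) * prod r N (suc a)) + p * prod r N a) (pow2[2+2d] d))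
    (trans (regroup (r N) (pow2 (d ℕ.+ d)) (prod r N (suc a)) (prod r N a))
           (cong (_* (r N * prod r N (suc a) + prod r N a)) (sym (pow2[2+2d] d)))))
    where
    N = a ℕ.+ suc d
    regroup : ∀ r p x y → + 4 * r * (p * x) + + 4 * p * y ≡ + 4 * p * (r * x + y)
    regroup = solve-∀

  E-scale : ∀ m a d → a ℕ.+ d ≡ 2 ℕ.^ m → E m a ≡ pow2 (d ℕ.+ d) * H m a
  E-scale m = prod-scale H-root

  conv-scaleˡ : ∀ c f g k → conv (λ i → c * f i) g k ≡ c * conv f g k
  conv-scaleˡ c f g zero    = ℤ.*-assoc c (f 0) (g 0)
  conv-scaleˡ c f g (suc k) = trans (cong (_+_ (c * f 0 * g (suc k))) (conv-scaleˡ c (tail f) g k))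
    (factor c (f 0) (g (suc k)) (conv (tail f) g k))
    where
    factor : ∀ c x y z → c * x * y + c * z ≡ c * (x * y + z)
    factor = solve-∀

  ≤-or-> : ∀ a N → (∃[ d ] a ℕ.+ d ≡ N) ⊎ N ℕ.< a
  ≤-or-> a N with a ℕ.≤? N
  ... | yes a≤N = inj₁ (ℕ.m≤n⇒∃[o]m+o≡n a≤N)
  ... | no  a≰N = inj₂ (ℕ.≰⇒> a≰N)

  -- Passing from `H` to `E` gains a factor 2: below the top there is a power of 4, at the top 2b =
  -- 2^(m+1), and beyond it the coefficient vanishes.
  2θE-∣ : ∀ m b → pow2 m ∣ + 2 * (+ b * H m b) → pow2 (suc m) ∣ + 2 * (+ b * E m b)
  2θE-∣ m b d with ≤-or-> b (2 ℕ.^ m)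
  ... | inj₂ M<b = ∣-via (trans (cong (λ x → + 2 * (+ b * x)) (prod-degree _ M<b)) (cong (+ 2 *_) (ℤ.*-zeroʳ (+ b))))
                         (pow2 (suc m) ∣0)
  ... | inj₁ (zero , b+0≡M) =
    pow2-∣-* 1 m {+ 2} ∣-refl (∣m⇒∣m*n (E m b) (∣-via (cong +_ (trans (sym (ℕ.+-identityʳ b)) b+0≡M)) ∣-refl))
  ... | inj₁ (suc c , b+c≡M) = ∣-via
    (trans (cong (λ x → + 2 * (+ b * x)) (E-scale m b (suc c) b+c≡M)) (rotate (+ b) (pow2 (suc c ℕ.+ suc c)) (H m b)))
    (pow2-∣-* 1 m (pow2-∣ {1} {suc c ℕ.+ suc c} (s≤s z≤n)) d)
    where
    rotate : ∀ b p x → + 2 * (b * (p * x)) ≡ p * (+ 2 * (b * x))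
    rotate = solve-∀

  -- Induction on m by Leibniz's rule for θ on the product of `O` and `E`. The factor 2 serves the
  -- leading coefficient of `E`, where b E_b is only 2^m.
  2θH-∣ : ∀ m k → pow2 m ∣ + 2 * (+ k * H m k)
  2θH-∣ zero    k = pow2-0-∣ _
  2θH-∣ (suc m) k = ∣-via
    (trans (cong (λ x → + 2 * (+ k * x)) (H-split m k))
      (trans (sym (ℤ.*-assoc (+ 2) (+ k) _)) (sym (conv-scaleˡ (+ 2 * + k) (O m) (E m) k))))
    (conv-terms-∣ (λ i → + 2 * + k * O m i) (E m) k terms)
    where
    leibniz : ∀ a b x y → + 2 * (a + b) * x * y ≡ + 2 * (a * x) * y + x * (+ 2 * (b * y))
    leibniz = solve-∀
    terms : ∀ a b → a ℕ.+ b ≡ k → pow2 (suc m) ∣ + 2 * + k * O m a * E m b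
    terms a b refl = ∣-via (leibniz (+ a) (+ b) (O m a) (E m b)) (∣m∣n⇒∣m+n
      (∣m⇒∣m*n (E m b) (pow2-∣-* 1 m {+ 2} ∣-refl (θO-∣ m a)))
      (∣n⇒∣m*n (O m a) (2θE-∣ m b (2θH-∣ m b))))

  -- Valuations of the coefficients of H

  -- Outside this block `h` is known only through `h-unique` and `h₀`, so `v₂` is never unfolded on
  -- coefficients.
  opaque
    h : ℕ → ℕ → ℕ
    h m i = v₂ ∣ H m i ∣

    h-unique : ∀ {m i e} → Val e (H m i) → h m i ≡ e
    h-unique = v₂-Val

    h₀ : ∀ i → i ℕ.≤ 1 → h 0 i ≡ 0
    h₀ 0 _ = refl
    h₀ 1 _ = refl
    h₀ (suc (suc _)) (s≤s ())

  -- The invariant of the recursion on m. `spread` makes the chosen term dominate in the lower half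
  -- of the next product; `drop` is what the passage to Stirling numbers requires.
  record Profile (m : ℕ) : Set where
    field
      val    : ∀ i → i ℕ.≤ 2 ℕ.^ m → Val (h m i) (H m i)
      spread : ∀ a i → a ℕ.≤ i → i ℕ.≤ 2 ℕ.^ m → h m i ℕ.≤ m ℕ.+ h m a
      drop   : ∀ i → 1 ℕ.≤ i → i ℕ.< 2 ℕ.^ m → h m i ℕ.< m ℕ.+ m ℕ.+ h m (suc i)

  -- The term O_0 E_i dominates. In another term O_a E_b the factor E_b carries an extra 4^a, which
  -- together with O_a yields 2^(m+1); by `spread` this outweighs h_i - h_b ≤ m.
  H-low-val : ∀ m → Profile m → ∀ i d → i ℕ.+ d ≡ 2 ℕ.^ m → Val (d ℕ.+ d ℕ.+ h m i) (H (suc m) i)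
  H-low-val m profile i d i+d≡M = subst (Val _) (sym (H-split m i))
    (Val-resp-∣ dominant (conv-dominant-∣ (O m) (E m) 0 i terms))
    where
    open Profile profile
    i≤M : i ℕ.≤ 2 ℕ.^ m
    i≤M = subst (i ℕ.≤_) i+d≡M (ℕ.m≤m+n i d)
    dominant : Val (d ℕ.+ d ℕ.+ h m i) (O m 0 * E m i)
    dominant = Val-* (O₀-odd m) (subst (Val _) (sym (E-scale m i d i+d≡M)) (Val-* (Val-pow2 (d ℕ.+ d)) (val i i≤M)))
    rearrange : ∀ p q x y → x * (p * q * y) ≡ p * (q * x * y)
    rearrange = solve-∀
    terms : ∀ a b → a ℕ.+ b ≡ i → a ≢ 0 → pow2 (suc (d ℕ.+ d ℕ.+ h m i)) ∣ O m a * E m b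
    terms a b refl a≢0 = ∣-via product≡
      (∣-trans (pow2-∣ (ℕ.≤-reflexive (sym (ℕ.+-suc (d ℕ.+ d) (h m i)))))
        (pow2-∣-+ (d ℕ.+ d) (suc (h m i))
          (∣-trans (pow2-∣ (s≤s (spread b i (ℕ.m≤n+m b a) i≤M)))
            (pow2-∣-* (suc m) (h m b) (4^j*O-∣ m a (ℕ.n≢0⇒n>0 a≢0))
              (Val⇒∣ (val b (ℕ.≤-trans (ℕ.m≤n+m b a) i≤M)) ℕ.≤-refl)))))
      where
      open ≡-Reasoning
      b+[d+a]≡M : b ℕ.+ (d ℕ.+ a) ≡ 2 ℕ.^ m
      b+[d+a]≡M = trans (trans (cong (b ℕ.+_) (ℕ.+-comm d a)) (trans (sym (ℕ.+-assoc b a d)) (cong (ℕ._+ d) (ℕ.+-comm b a)))) i+d≡M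
      double-+ : (d ℕ.+ a) ℕ.+ (d ℕ.+ a) ≡ (d ℕ.+ d) ℕ.+ (a ℕ.+ a)
      double-+ = ℕ+.interchange d a d a
      product≡ : O m a * E m b ≡ pow2 (d ℕ.+ d) * (pow2 (a ℕ.+ a) * O m a * H m b)
      product≡ = begin
        O m a * E m b
          ≡⟨ cong (O m a *_) (E-scale m b (d ℕ.+ a) b+[d+a]≡M) ⟩
        O m a * (pow2 ((d ℕ.+ a) ℕ.+ (d ℕ.+ a)) * H m b)
          ≡⟨ cong (λ p → O m a * (p * H m b)) (trans (cong pow2 double-+) (pow2-+ (d ℕ.+ d) (a ℕ.+ a))) ⟩
        O m a * (pow2 (d ℕ.+ d) * pow2 (a ℕ.+ a) * H m b)
          ≡⟨ rearrange (pow2 (d ℕ.+ d)) (pow2 (a ℕ.+ a)) (O m a) (H m b) ⟩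
        pow2 (d ℕ.+ d) * (pow2 (a ℕ.+ a) * O m a * H m b) ∎

  E-even : ∀ m c d → c ℕ.+ suc d ≡ 2 ℕ.^ m → pow2 1 ∣ E m c
  E-even m c d eq = ∣-via (E-scale m c (suc d) eq)
    (∣m⇒∣m*n (H m c) (pow2-∣ {1} {suc d ℕ.+ suc d} (s≤s z≤n)))

  -- The dominant term is O_b E_M = O_b, as `E` is monic. For b ≥ 1 the multiples by b of the other
  -- terms are divisible by 2^(m+1); cancelling t = v(b) leaves 2^(e+1), since t + e = m.
  H-high-val : ∀ m b → b ℕ.≤ 2 ℕ.^ m → ∃[ e ] e ℕ.≤ m × Val e (H (suc m) (b ℕ.+ 2 ℕ.^ m))
  H-high-val m b b≤M = assemble b b≤M
    where
    M = 2 ℕ.^ m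

    from-terms : ∀ b e → Val e (O m b) →
      (∀ a c d → a ℕ.+ c ≡ b ℕ.+ M → c ℕ.+ suc d ≡ M → pow2 (suc e) ∣ O m a * E m c) → Val e (H (suc m) (b ℕ.+ M))
    from-terms b e vO small = subst (Val e) (sym (H-split m (b ℕ.+ M)))
      (Val-resp-∣ (subst (Val e) (sym (trans (cong (O m b *_) (prod-monic _ M)) (ℤ.*-identityʳ (O m b)))) vO)
        (conv-dominant-∣ (O m) (E m) b M terms))
      where
      terms : ∀ a c → a ℕ.+ c ≡ b ℕ.+ M → a ≢ b → pow2 (suc e) ∣ O m a * E m c
      terms a c a+c≡ a≢b with ≤-or-> c M
      ... | inj₂ M<c = ∣-via (trans (cong (O m a *_) (prod-degree _ M<c)) (ℤ.*-zeroʳ (O m a))) (pow2 (suc e) ∣0)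
      ... | inj₁ (suc d , c+d≡M) = small a c d a+c≡ c+d≡M
      ... | inj₁ (zero , c+0≡M) = contradiction
        (ℕ.+-cancelʳ-≡ M a b (trans (cong (a ℕ.+_) (trans (sym c+0≡M) (ℕ.+-identityʳ c))) a+c≡)) a≢b

    -- Multiplying a term O_a E_c by b = a + c - M distributes over the bounds on a O_a and c E_c.
    b*term-∣ : ∀ b a c d → a ℕ.+ c ≡ b ℕ.+ M → c ℕ.+ suc d ≡ M → pow2 (suc m) ∣ + b * (O m a * E m c)
    b*term-∣ b a c d a+c≡ c+d≡M = ∣-via
      (trans (cong (_* (O m a * E m c)) b≡) (distribute (+ a) (+ c) (pow2 m) (O m a) (E m c)))
      (∣m∣n⇒∣m-n (∣m∣n⇒∣m+n
        (∣-trans m+1 (pow2-∣-* m 1 (θO-∣ m a) (E-even m c d c+d≡M)))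
        (∣n⇒∣m*n (O m a) cE-∣))
        (∣n⇒∣m*n (O m a) (∣-trans m+1 (pow2-∣-* m 1 {pow2 m} ∣-refl (E-even m c d c+d≡M)))))
      where
      m+1 : pow2 (suc m) ∣ pow2 (m ℕ.+ 1)
      m+1 = pow2-∣ (ℕ.≤-reflexive (ℕ.+-comm 1 m))
      distribute : ∀ a c M x y → (a + c - M) * (x * y) ≡ a * x * y + x * (c * y) - x * (M * y)
      distribute = solve-∀
      b≡ : + b ≡ + a + + c - pow2 m
      b≡ = trans (cancel (+ b) (pow2 m)) (cong (λ n → + n - pow2 m) (sym a+c≡))
        where
        cancel : ∀ x y → x ≡ x + y - y
        cancel = solve-∀
      -- One factor 2 of 4^(d+1) is spent on 2 c H_c, to which `2θH-∣` applies; another raises 2^m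
      -- to 2^(m+1).
      cE≡ : + c * E m c ≡ (+ 2 * pow2 (d ℕ.+ d)) * (+ 2 * (+ c * H m c))
      cE≡ = trans (cong (+ c *_) (trans (E-scale m c (suc d) c+d≡M) (cong (_* H m c) (pow2[2+2d] d))))
        (regroup (+ c) (pow2 (d ℕ.+ d)) (H m c))
        where
        regroup : ∀ c p x → c * (+ 4 * p * x) ≡ + 2 * p * (+ 2 * (c * x))
        regroup = solve-∀
      cE-∣ : pow2 (suc m) ∣ + c * E m c
      cE-∣ = ∣-via cE≡ (pow2-∣-* 1 m (∣m⇒∣m*n (pow2 (d ℕ.+ d)) ∣-refl) (2θH-∣ m c))

    positive : ∀ b → ValPair m b (O m b) → ∃[ e ] e ℕ.≤ m × Val e (H (suc m) (b ℕ.+ M))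
    positive b (valPair {t} {e} t+e≡m vb vO) = e , subst (e ℕ.≤_) t+e≡m (ℕ.m≤n+m e t) , from-terms b e vO small
      where
      t+[1+e]≤1+m : t ℕ.+ suc e ℕ.≤ suc m
      t+[1+e]≤1+m = ℕ.≤-reflexive (trans (ℕ.+-suc t e) (cong suc t+e≡m))
      small : ∀ a c d → a ℕ.+ c ≡ b ℕ.+ M → c ℕ.+ suc d ≡ M → pow2 (suc e) ∣ O m a * E m c
      small a c d a+c≡ c+d≡M = Val-cancel-∣ t (suc e) {+ b} {O m a * E m c} vb
        (∣-trans (pow2-∣ t+[1+e]≤1+m) (b*term-∣ b a c d a+c≡ c+d≡M))

    assemble : ∀ b → b ℕ.≤ M → ∃[ e ] e ℕ.≤ m × Val e (H (suc m) (b ℕ.+ M))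
    -- Multiplication by b = 0 carries no information; here O_0 is odd, and it suffices that each
    -- E_c with c < M is even.
    assemble zero    _   = 0 , z≤n , from-terms 0 0 (O₀-odd m) λ a c d _ c+d≡M → ∣n⇒∣m*n (O m a) (E-even m c d c+d≡M)
    assemble (suc b) b≤M = positive (suc b) (O-val m (suc b) (s≤s z≤n) b≤M)

  profile : ∀ m → Profile m
  profile zero = record
    { val    = λ i i≤1 → subst (λ e → Val e (H 0 i)) (sym (h₀ i i≤1)) (odd i i≤1)
    ; spread = λ a i _ i≤1 → subst (ℕ._≤ h 0 a) (sym (h₀ i i≤1)) z≤n
    ; drop   = λ { (suc _) _ (s≤s ()) }
    }
    where
    odd : ∀ i → i ℕ.≤ 1 → Val 0 (H 0 i)
    odd 0 _ = - 1ℤ , refl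
    odd 1 _ = 0ℤ , refl
    odd (suc (suc _)) (s≤s ())
  profile (suc m) = record { val = val′ ; spread = spread′ ; drop = drop′ }
    where
    open Profile (profile m)
    M = 2 ℕ.^ m

    -- The middle index M counts as high. `h-low` also covers it, with d = 0, so `drop′` may step
    -- from any low i to `suc i`.
    data Half (i : ℕ) : Set where
      low  : ∀ d → i ℕ.+ suc d ≡ M → Half i
      high : ∀ b → b ℕ.≤ M → b ℕ.+ M ≡ i → Half i

    half : ∀ i → i ℕ.≤ 2 ℕ.^ suc m → Half i
    half i i≤2M with ≤-or-> M i
    ... | inj₁ (b , M+b≡i) = high b b≤M b+M≡i
      where
      b+M≡i : b ℕ.+ M ≡ i
      b+M≡i = trans (ℕ.+-comm b M) M+b≡i
      b≤M : b ℕ.≤ M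
      b≤M = ℕ.+-cancelʳ-≤ M b M (subst₂ ℕ._≤_ (sym b+M≡i) (2^[1+m] m) i≤2M)
    ... | inj₂ i<M with ℕ.m≤n⇒∃[o]m+o≡n i<M
    ...   | d , eq = low d (trans (ℕ.+-suc i d) eq)

    h-low : ∀ i d → i ℕ.+ d ≡ M → h (suc m) i ≡ d ℕ.+ d ℕ.+ h m i
    h-low i d eq = h-unique (H-low-val m (profile m) i d eq)

    h-high : ∀ b → b ℕ.≤ M → h (suc m) (b ℕ.+ M) ℕ.≤ m
    h-high b b≤M = let _ , e≤m , v = H-high-val m b b≤M in subst (ℕ._≤ m) (sym (h-unique v)) e≤m

    val′ : ∀ i → i ℕ.≤ 2 ℕ.^ suc m → Val (h (suc m) i) (H (suc m) i)
    val′ i i≤2M with half i i≤2M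
    ... | low d eq = subst (λ e → Val e (H (suc m) i)) (sym (h-low i (suc d) eq)) (H-low-val m (profile m) i (suc d) eq)
    ... | high b b≤M refl =
      let _ , _ , v = H-high-val m b b≤M in subst (λ e → Val e (H (suc m) i)) (sym (h-unique v)) v

    spread′ : ∀ a i → a ℕ.≤ i → i ℕ.≤ 2 ℕ.^ suc m → h (suc m) i ℕ.≤ suc m ℕ.+ h (suc m) a
    spread′ a i a≤i i≤2M with half i i≤2M
    ... | high b b≤M refl = ℕ.≤-trans (h-high b b≤M) (ℕ.≤-trans (ℕ.n≤1+n m) (ℕ.m≤m+n (suc m) _))
    ... | low d i+d≡M with ℕ.m≤n⇒∃[o]m+o≡n a≤i
    ...   | c , refl = begin
      h (suc m) i                             ≡⟨ h-low i (suc d) i+d≡M ⟩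
      D ℕ.+ D ℕ.+ h m i                       ≤⟨ ℕ.+-mono-≤ (ℕ.+-mono-≤ (ℕ.m≤n+m D c) (ℕ.m≤n+m D c))
                                                   (spread a i a≤i (subst (i ℕ.≤_) i+d≡M (ℕ.m≤m+n i D))) ⟩
      (c ℕ.+ D) ℕ.+ (c ℕ.+ D) ℕ.+ (m ℕ.+ h m a) ≡⟨ ℕ+.x∙yz≈y∙xz ((c ℕ.+ D) ℕ.+ (c ℕ.+ D)) m (h m a) ⟩
      m ℕ.+ ((c ℕ.+ D) ℕ.+ (c ℕ.+ D) ℕ.+ h m a) ≡⟨ cong (m ℕ.+_) (h-low a (c ℕ.+ D) (trans (sym (ℕ.+-assoc a c D)) i+d≡M)) ⟨
      m ℕ.+ h (suc m) a                       ≤⟨ ℕ.n≤1+n _ ⟩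
      suc m ℕ.+ h (suc m) a                   ∎
      where
      open ℕ.≤-Reasoning
      D = suc d

    drop′ : ∀ i → 1 ℕ.≤ i → i ℕ.< 2 ℕ.^ suc m → h (suc m) i ℕ.< suc m ℕ.+ suc m ℕ.+ h (suc m) (suc i)
    drop′ i 1≤i i<2M with half i (ℕ.<⇒≤ i<2M)
    ... | high b b≤M refl = ℕ.≤-trans (s≤s (h-high b b≤M))
            (ℕ.≤-trans (ℕ.m≤m+n (suc m) (suc m)) (ℕ.m≤m+n (suc m ℕ.+ suc m) _))
    ... | low d i+d≡M = begin-strict
      h (suc m) i                                         ≡⟨ h-low i (suc d) i+d≡M ⟩
      suc d ℕ.+ suc d ℕ.+ h m i                           <⟨ ℕ.+-monoʳ-< (suc d ℕ.+ suc d) (drop i 1≤i i<M) ⟩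
      -- Lowering `suc d` to `d` costs 2, exactly the increase from 2m to 2(m + 1).
      suc d ℕ.+ suc d ℕ.+ (m ℕ.+ m ℕ.+ h m (suc i))       ≡⟨ regroup d m (h m (suc i)) ⟩
      suc m ℕ.+ suc m ℕ.+ (d ℕ.+ d ℕ.+ h m (suc i))       ≡⟨ cong (suc m ℕ.+ suc m ℕ.+_) (h-low (suc i) d 1+i+d≡M) ⟨
      suc m ℕ.+ suc m ℕ.+ h (suc m) (suc i)               ∎
      where
      open ℕ.≤-Reasoning
      1+i+d≡M : suc i ℕ.+ d ≡ M
      1+i+d≡M = trans (sym (ℕ.+-suc i d)) i+d≡M
      i<M : i ℕ.< M
      i<M = subst (suc i ℕ.≤_) 1+i+d≡M (ℕ.m≤m+n (suc i) d)
      regroup : ∀ d m x → suc d ℕ.+ suc d ℕ.+ (m ℕ.+ m ℕ.+ x) ≡ suc m ℕ.+ suc m ℕ.+ (d ℕ.+ d ℕ.+ x)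
      regroup = ℕ-solver.solve-∀

  -- From H to Stirling numbers

  sumTo : ℕ → (ℕ → ℤ) → ℤ
  sumTo zero    t = t 0
  sumTo (suc D) t = t (suc D) + sumTo D t

  sumTo-∣ : ∀ {d} D t → (∀ i → i ℕ.≤ D → d ∣ t i) → d ∣ sumTo D t
  sumTo-∣ zero    t dt = dt 0 z≤n
  sumTo-∣ (suc D) t dt = ∣m∣n⇒∣m+n (dt (suc D) ℕ.≤-refl) (sumTo-∣ D t λ i i≤D → dt i (ℕ.m≤n⇒m≤1+n i≤D))

  sumTo-dominant-∣ : ∀ {d} D t j → j ℕ.≤ D → (∀ i → i ℕ.≤ D → i ≢ j → d ∣ t i) → d ∣ sumTo D t - t j
  sumTo-dominant-∣ {d} zero    t zero z≤n  dt = ∣-via (ℤ.+-inverseʳ (t 0)) (d ∣0)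
  sumTo-dominant-∣     (suc D) t j    j≤1+D dt with ℕ.m≤n⇒m<n∨m≡n j≤1+D
  ... | inj₂ refl = ∣-via (cancel (t j) (sumTo D t))
          (sumTo-∣ D t λ i i≤D → dt i (ℕ.m≤n⇒m≤1+n i≤D) (ℕ.<⇒≢ (s≤s i≤D)))
    where
    cancel : ∀ x y → x + y - x ≡ y
    cancel = solve-∀
  ... | inj₁ (s≤s j≤D) = ∣-via (ℤ.+-assoc (t (suc D)) (sumTo D t) (- t j)) (∣m∣n⇒∣m+n
          (dt (suc D) ℕ.≤-refl (λ eq → ℕ.<⇒≢ (s≤s j≤D) (sym eq)))
          (sumTo-dominant-∣ D t j j≤D λ i i≤D → dt i (ℕ.m≤n⇒m≤1+n i≤D)))

  Z : ℤ → ℕ → Poly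
  Z c = prod (λ _ → c)

  Z-subleading : ∀ c N → Z c (suc N) N ≡ + suc N * c
  Z-subleading c zero    = ℤ.*-comm c 1ℤ
  Z-subleading c (suc N) = trans
    (cong₂ (λ x y → c * x + y) (prod-monic (λ _ → c) (suc N)) (Z-subleading c N)) (collect c (+ suc N))
    where
    collect : ∀ c n → c * 1ℤ + n * c ≡ (1ℤ + n) * c
    collect = solve-∀

  -- The coefficient is a binomial coefficient times 2^(dm); Pascal's rule gives the divisibility
  -- directly.
  Z-∣ : ∀ m d k → pow2 (d ℕ.* m) ∣ Z (pow2 m) (d ℕ.+ k) k
  Z-∣ m zero    k       = pow2-0-∣ (Z (pow2 m) k k)
  Z-∣ m (suc d) zero    = pow2-∣-+ m (d ℕ.* m) (Z-∣ m d 0)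
  Z-∣ m (suc d) (suc k) = ∣m∣n⇒∣m+n (pow2-∣-+ m (d ℕ.* m) (Z-∣ m d (suc k)))
    (subst (λ n → pow2 (suc d ℕ.* m) ∣ Z (pow2 m) n k) (sym (ℕ.+-suc d k)) (Z-∣ m (suc d) k))

  -- Σ_{i≤D} f_i (x + c)^{2i+1}
  S : ℤ → ℕ → Poly → Poly
  S c D f k = sumTo D (λ i → f i * Z c (suc (i ℕ.* 2)) k)

  lin-linear : ∀ a x f g k → lin a (λ i → x * f i + g i) k ≡ x * lin a f k + lin a g k
  lin-linear a x f g zero    = distrib a x (f 0) (g 0)
    where
    distrib : ∀ a x y z → a * (x * y + z) ≡ x * (a * y) + a * z
    distrib = solve-∀
  lin-linear a x f g (suc k) = distrib a x (f (suc k)) (g (suc k)) (f k) (g k)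
    where
    distrib : ∀ a x y z u w → a * (x * y + z) + (x * u + w) ≡ x * (a * y + u) + (a * z + w)
    distrib = solve-∀

  lin-scale : ∀ a x f k → lin a (λ i → x * f i) k ≡ x * lin a f k
  lin-scale a x f zero    = swap a x (f 0)
    where
    swap : ∀ a x y → a * (x * y) ≡ x * (a * y)
    swap = solve-∀
  lin-scale a x f (suc k) = distrib a x (f (suc k)) (f k)
    where
    distrib : ∀ a x y z → a * (x * y) + x * z ≡ x * (a * y + z)
    distrib = solve-∀

  -- Under z = (x + c)² the factor z + a becomes (x + c)² + a. Truncation at D loses the term f_D (x
  -- + c)^(2D+3), restored on the left.
  S-lin : ∀ c a D f k → S c D (lin a f) k + f D * Z c (suc (suc D ℕ.* 2)) k
                      ≡ lin c (lin c (S c D f)) k + a * S c D f k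
  S-lin c a zero    f k = trans (regroup a (f 0) (Z c 1 k) (Z c 3 k))
    (cong (_+ a * S c 0 f k) (sym (trans (lin-cong refl (lin-scale c (f 0) (Z c 1)) k) (lin-scale c (f 0) (Z c 2) k))))
    where
    regroup : ∀ a x y z → a * x * y + x * z ≡ x * z + a * (x * y)
    regroup = solve-∀
  S-lin c a (suc D) f k = begin
    (a * f (suc D) + f D) * Y₁ + S c D (lin a f) k + f (suc D) * Y₂
      ≡⟨ regroup a (f (suc D)) (f D) Y₁ (S c D (lin a f) k) Y₂ ⟩
    (a * f (suc D)) * Y₁ + (S c D (lin a f) k + f D * Y₁) + f (suc D) * Y₂
      ≡⟨ cong (λ x → (a * f (suc D)) * Y₁ + x + f (suc D) * Y₂) (S-lin c a D f k) ⟩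
    (a * f (suc D)) * Y₁ + (lin c (lin c (S c D f)) k + a * S c D f k) + f (suc D) * Y₂
      ≡⟨ collect a (f (suc D)) Y₁ Y₂ (lin c (lin c (S c D f)) k) (S c D f k) ⟩
    f (suc D) * Y₂ + lin c (lin c (S c D f)) k + a * S c (suc D) f k
      ≡⟨ cong (_+ a * S c (suc D) f k) (sym lin²) ⟩
    lin c (lin c (S c (suc D) f)) k + a * S c (suc D) f k ∎
    where
    open ≡-Reasoning
    Y₁ = Z c (suc (suc D ℕ.* 2)) k
    Y₂ = Z c (suc (suc (suc D) ℕ.* 2)) k
    regroup : ∀ a x x′ y s z → (a * x + x′) * y + s + x * z ≡ (a * x) * y + (s + x′ * y) + x * z
    regroup = solve-∀
    collect : ∀ a x y z l s → (a * x) * y + (l + a * s) + x * z ≡ x * z + l + a * (x * y + s)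
    collect = solve-∀
    lin² : lin c (lin c (S c (suc D) f)) k ≡ f (suc D) * Y₂ + lin c (lin c (S c D f)) k
    lin² = trans (lin-cong refl (lin-linear c (f (suc D)) (Z c (suc (suc D ℕ.* 2))) (S c D f)) k)
                 (lin-linear c (f (suc D)) (Z c (suc (suc (suc D ℕ.* 2)))) (lin c (S c D f)) k)

  lin-difference-of-squares : ∀ c s f k → lin (c + s) (lin (c - s) f) k ≡ lin c (lin c f) k + - (s * s) * f k
  lin-difference-of-squares c s f zero = expand c s (f 0)
    where
    expand : ∀ c s x → (c + s) * ((c - s) * x) ≡ c * (c * x) + - (s * s) * x
    expand = solve-∀
  lin-difference-of-squares c s f (suc zero) = expand c s (f 1) (f 0)
    where
    expand : ∀ c s x y → (c + s) * ((c - s) * x + y) + (c - s) * y ≡ c * (c * x + y) + c * y + - (s * s) * x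
    expand = solve-∀
  lin-difference-of-squares c s f (suc (suc k)) = expand c s (f (suc (suc k))) (f (suc k)) (f k)
    where
    expand : ∀ c s x y z → (c + s) * ((c - s) * x + y) + ((c - s) * y + z)
                         ≡ c * (c * x + y) + (c * y + z) + - (s * s) * x
    expand = solve-∀

  -- ∏_{|i|≤L} (x + c + i)
  centred : ℤ → ℕ → Poly
  centred c zero    = lin c one
  centred c (suc L) = lin (c + + suc L) (lin (c - + suc L) (centred c L))

  S-one : ∀ c D → S c D one ≗ Z c 1
  S-one c zero    k = ℤ.*-identityˡ (Z c 1 k)
  S-one c (suc D) k = trans (ℤ.+-identityˡ _) (S-one c D k)

  -- Pairing x + c + s with x + c - s gives z - s² at z = (x + c)², and the unpaired x + c makes all
  -- exponents odd. The truncation D stays fixed while L grows.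
  centred≗S : ∀ c D L → L ℕ.≤ D → centred c L ≗ S c D (prod H-root L)
  centred≗S c D zero    _   k = sym (S-one c D k)
  centred≗S c D (suc L) L<D k = begin
    lin (c + s) (lin (c - s) (centred c L)) k
      ≡⟨ lin-cong refl (lin-cong refl (centred≗S c D L (ℕ.<⇒≤ L<D))) k ⟩
    lin (c + s) (lin (c - s) (S c D P)) k
      ≡⟨ lin-difference-of-squares c s (S c D P) k ⟩
    lin c (lin c (S c D P)) k + - (s * s) * S c D P k
      ≡⟨ S-lin c (- (s * s)) D P k ⟨
    S c D (prod H-root (suc L)) k + P D * Z c (suc (suc D ℕ.* 2)) k
      -- `P` has degree L < D, so the truncation term of `S-lin` vanishes.
      ≡⟨ cong (λ x → S c D (prod H-root (suc L)) k + x * Z c (suc (suc D ℕ.* 2)) k) (prod-degree H-root L<D) ⟩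
    S c D (prod H-root (suc L)) k + 0ℤ
      ≡⟨ ℤ.+-identityʳ _ ⟩
    S c D (prod H-root (suc L)) k ∎
    where
    open ≡-Reasoning
    s = + suc L
    P = prod H-root L

  rising : ℤ → ℕ → Poly
  rising a = prod (λ i → a + + i)

  -- `prod` appends factors at the end; extracting the first one lets `centred≗rising` extend the
  -- range on both sides.
  rising-suc : ∀ a N → rising a (suc N) ≗ lin a (rising (a + 1ℤ) N)
  rising-suc a zero    = lin-cong (ℤ.+-identityʳ a) λ _ → refl
  rising-suc a (suc N) k = begin
    lin (a + + suc N) (rising a (suc N)) k              ≡⟨ lin-cong (sym (ℤ.+-assoc a 1ℤ (+ N))) (rising-suc a N) k ⟩
    lin (a + 1ℤ + + N) (lin a (rising (a + 1ℤ) N)) k    ≡⟨ lin-comm (a + 1ℤ + + N) a (rising (a + 1ℤ) N) k ⟩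
    lin a (rising (a + 1ℤ) (suc N)) k                   ∎
    where open ≡-Reasoning

  centred≗rising : ∀ c L → centred c L ≗ rising (c - + L) (suc (L ℕ.* 2))
  centred≗rising c zero    = lin-cong (sym (trans (ℤ.+-identityʳ _) (ℤ.+-identityʳ c))) λ _ → refl
  centred≗rising c (suc L) k = begin
    lin (c + + suc L) (lin a (centred c L)) k
      ≡⟨ lin-cong last (lin-cong refl (λ j → trans (centred≗rising c L j)
           (prod-cong (λ i → cong (_+ + i) (first c (+ L))) (suc (L ℕ.* 2)) j))) k ⟩
    lin (a + + suc (suc (L ℕ.* 2))) (lin a (rising (a + 1ℤ) (suc (L ℕ.* 2)))) k
      ≡⟨ lin-cong refl (rising-suc a (suc (L ℕ.* 2))) k ⟨
    rising a (suc (suc L ℕ.* 2)) k ∎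
    where
    open ≡-Reasoning
    a = c - + suc L
    first : ∀ c l → c - l ≡ c - (1ℤ + l) + 1ℤ
    first = solve-∀
    last : c + + suc L ≡ a + + suc (suc (L ℕ.* 2))
    last = trans (shift c (+ L)) (cong (λ x → a + (1ℤ + (1ℤ + x))) (sym (ℤ.pos-* L 2)))
      where
      shift : ∀ c l → c + (1ℤ + l) ≡ c - (1ℤ + l) + (1ℤ + (1ℤ + l * + 2))
      shift = solve-∀

  stirling1≡rising : ∀ N k → + stirling1 N k ≡ rising 0ℤ N k
  stirling1≡rising zero          zero    = refl
  stirling1≡rising zero          (suc k) = refl
  stirling1≡rising (suc zero)    zero    = refl
  stirling1≡rising (suc (suc N)) zero    =
    trans (sym (ℤ.*-zeroʳ (+ suc N))) (cong (+ suc N *_) (stirling1≡rising (suc N) 0))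
  stirling1≡rising (suc N)       (suc k) = cong₂ _+_
    (trans (ℤ.pos-* N (stirling1 N (suc k))) (cong (+ N *_) (stirling1≡rising N (suc k)))) (stirling1≡rising N k)

  -- With centre c = M = 2^m the first factor is x + c - M = x, so the centred product is the rising
  -- factorial of length 2M + 1.
  stirling1≡S : ∀ m k → + stirling1 (suc (2 ℕ.^ m ℕ.* 2)) k ≡ S (pow2 m) (2 ℕ.^ m) (H m) k
  stirling1≡S m k = begin
    + stirling1 (suc (M ℕ.* 2)) k           ≡⟨ stirling1≡rising (suc (M ℕ.* 2)) k ⟩
    rising 0ℤ (suc (M ℕ.* 2)) k             ≡⟨ cong (λ a → rising a (suc (M ℕ.* 2)) k) (ℤ.+-inverseʳ (pow2 m)) ⟨
    rising (pow2 m - + M) (suc (M ℕ.* 2)) k ≡⟨ centred≗rising (pow2 m) M k ⟨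
    centred (pow2 m) M k                    ≡⟨ centred≗S (pow2 m) M M ℕ.≤-refl k ⟩
    S (pow2 m) M (H m) k                    ∎
    where
    open ≡-Reasoning
    M = 2 ℕ.^ m

  -- `drop` iterated, in the form that is weighed against the powers of 2^m supplied by `Z-∣`.
  h-drop : ∀ m j d → 1 ℕ.≤ j → j ℕ.+ suc d ℕ.≤ 2 ℕ.^ m →
           h m j ℕ.< h m (j ℕ.+ suc d) ℕ.+ suc d ℕ.* 2 ℕ.* m
  h-drop m j zero 1≤j j<M = begin-strict
    h m j                                <⟨ Profile.drop (profile m) j 1≤j (subst (ℕ._≤ 2 ℕ.^ m) (ℕ.+-comm j 1) j<M) ⟩
    m ℕ.+ m ℕ.+ h m (suc j)              ≡⟨ cong (λ i → m ℕ.+ m ℕ.+ h m i) (ℕ.+-comm 1 j) ⟩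
    m ℕ.+ m ℕ.+ h m (j ℕ.+ 1)            ≡⟨ regroup m (h m (j ℕ.+ 1)) ⟩
    h m (j ℕ.+ 1) ℕ.+ 2 ℕ.* m            ∎
    where
    open ℕ.≤-Reasoning
    regroup : ∀ m x → m ℕ.+ m ℕ.+ x ≡ x ℕ.+ 2 ℕ.* m
    regroup = ℕ-solver.solve-∀
  h-drop m j (suc d) 1≤j j+d≤M = begin-strict
    h m j                                             <⟨ h-drop m j 0 1≤j j+1≤M ⟩
    h m (j ℕ.+ 1) ℕ.+ 2 ℕ.* m                         <⟨ ℕ.+-monoˡ-< (2 ℕ.* m) (h-drop m (j ℕ.+ 1) d (ℕ.≤-trans 1≤j (ℕ.m≤m+n j 1)) (subst (ℕ._≤ 2 ℕ.^ m) (sym (ℕ.+-assoc j 1 (suc d))) j+d≤M)) ⟩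
    h m (j ℕ.+ 1 ℕ.+ suc d) ℕ.+ suc d ℕ.* 2 ℕ.* m ℕ.+ 2 ℕ.* m ≡⟨ cong (λ i → h m i ℕ.+ suc d ℕ.* 2 ℕ.* m ℕ.+ 2 ℕ.* m) (ℕ.+-assoc j 1 (suc d)) ⟩
    h m (j ℕ.+ suc (suc d)) ℕ.+ suc d ℕ.* 2 ℕ.* m ℕ.+ 2 ℕ.* m ≡⟨ regroup d m (h m (j ℕ.+ suc (suc d))) ⟩
    h m (j ℕ.+ suc (suc d)) ℕ.+ suc (suc d) ℕ.* 2 ℕ.* m ∎
    where
    open ℕ.≤-Reasoning
    j+1≤M : j ℕ.+ 1 ℕ.≤ 2 ℕ.^ m
    j+1≤M = ℕ.≤-trans (ℕ.+-monoʳ-≤ j (s≤s z≤n)) j+d≤M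
    regroup : ∀ d m x → x ℕ.+ suc d ℕ.* 2 ℕ.* m ℕ.+ 2 ℕ.* m ≡ x ℕ.+ suc (suc d) ℕ.* 2 ℕ.* m
    regroup = ℕ-solver.solve-∀

  -- ε ∈ {0, 1} selects the coefficient k = 2j + 1 - ε.
  summand-∣ : ∀ m j ε k → ε ℕ.+ k ≡ suc (j ℕ.* 2) → ε ℕ.≤ 1 → 1 ℕ.≤ j → ∀ i → i ℕ.≤ 2 ℕ.^ m → i ≢ j →
              pow2 (suc (h m j ℕ.+ ε ℕ.* m)) ∣ H m i * Z (pow2 m) (suc (i ℕ.* 2)) k
  summand-∣ m j ε k ε+k≡ ε≤1 1≤j i i≤M i≢j with ℕ.<-cmp i j
  ... | tri≈ _ i≡j _ = contradiction i≡j i≢j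
  ... | tri< i<j _ _ = ∣-via (trans (cong (H m i *_) (prod-degree _ 2i+1<k)) (ℤ.*-zeroʳ (H m i))) (_ ∣0)
    where
    2i+1<k : suc (i ℕ.* 2) ℕ.< k
    2i+1<k = ℕ.≤-trans (ℕ.*-monoˡ-≤ 2 i<j)
      (ℕ.s≤s⁻¹ (subst (ℕ._≤ suc k) ε+k≡ (ℕ.+-monoˡ-≤ k ε≤1)))
  -- For i = j + 1 + d the coefficient of (x + 2^m)^(2i+1) carries 2(d + 1) + ε factors 2^m, and by
  -- `h-drop` the first 2(d + 1) of them exceed h_j - h_i.
  ... | tri> _ _ j<i with ℕ.m≤n⇒∃[o]m+o≡n j<i
  ...   | d , refl = subst (λ n → pow2 (suc (h m j ℕ.+ ε ℕ.* m)) ∣ H m i * Z (pow2 m) n k) index≡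
          (∣-trans (pow2-∣ bound) (pow2-∣-* (h m i) ((suc d ℕ.* 2 ℕ.+ ε) ℕ.* m)
            (Val⇒∣ (Profile.val (profile m) i i≤M) ℕ.≤-refl) (Z-∣ m (suc d ℕ.* 2 ℕ.+ ε) k)))
    where
    open ℕ.≤-Reasoning
    index≡ : suc d ℕ.* 2 ℕ.+ ε ℕ.+ k ≡ suc (i ℕ.* 2)
    index≡ = trans (ℕ.+-assoc (suc d ℕ.* 2) ε k) (trans (cong (suc d ℕ.* 2 ℕ.+_) ε+k≡) (regroup d j))
      where
      regroup : ∀ d j → suc d ℕ.* 2 ℕ.+ suc (j ℕ.* 2) ≡ suc (suc (j ℕ.+ d) ℕ.* 2)
      regroup = ℕ-solver.solve-∀
    bound : suc (h m j ℕ.+ ε ℕ.* m) ℕ.≤ h m i ℕ.+ (suc d ℕ.* 2 ℕ.+ ε) ℕ.* m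
    bound = begin
      suc (h m j) ℕ.+ ε ℕ.* m                               ≤⟨ ℕ.+-monoˡ-≤ (ε ℕ.* m) (subst (λ n → h m j ℕ.< h m n ℕ.+ suc d ℕ.* 2 ℕ.* m)
                                                                 (ℕ.+-suc j d) (h-drop m j d 1≤j (subst (ℕ._≤ 2 ℕ.^ m) (sym (ℕ.+-suc j d)) i≤M))) ⟩
      h m i ℕ.+ suc d ℕ.* 2 ℕ.* m ℕ.+ ε ℕ.* m               ≡⟨ ℕ.+-assoc (h m i) (suc d ℕ.* 2 ℕ.* m) (ε ℕ.* m) ⟩
      h m i ℕ.+ (suc d ℕ.* 2 ℕ.* m ℕ.+ ε ℕ.* m)             ≡⟨ cong (h m i ℕ.+_) (ℕ.*-distribʳ-+ m (suc d ℕ.* 2) ε) ⟨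
      h m i ℕ.+ (suc d ℕ.* 2 ℕ.+ ε) ℕ.* m                   ∎

  -- Summand j dominates by `summand-∣`. The hypothesis on `Z` is met by the leading coefficient 1
  -- when ε = 0 and by the subleading one, (2j + 1) 2^m, when ε = 1.
  stirling1-val : ∀ m j ε k → ε ℕ.+ k ≡ suc (j ℕ.* 2) → ε ℕ.≤ 1 → 1 ℕ.≤ j → j ℕ.≤ 2 ℕ.^ m →
                  Val (ε ℕ.* m) (Z (pow2 m) (suc (j ℕ.* 2)) k) →
                  Val (h m j ℕ.+ ε ℕ.* m) (+ stirling1 (suc (2 ℕ.^ m ℕ.* 2)) k)
  stirling1-val m j ε k ε+k≡ ε≤1 1≤j j≤M vZ = subst (Val (h m j ℕ.+ ε ℕ.* m)) (sym (stirling1≡S m k))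
    (Val-resp-∣ (Val-* (Profile.val (profile m) j j≤M) vZ)
      (sumTo-dominant-∣ (2 ℕ.^ m) (λ i → H m i * Z (pow2 m) (suc (i ℕ.* 2)) k) j j≤M
        (summand-∣ m j ε k ε+k≡ ε≤1 1≤j)))

  stirling1-val-odd : ∀ m j → 1 ℕ.≤ j → j ℕ.≤ 2 ℕ.^ m → Val (h m j) (+ stirling1 (suc (2 ℕ.^ m ℕ.* 2)) (suc (j ℕ.* 2)))
  stirling1-val-odd m j 1≤j j≤M = subst (λ e → Val e (+ stirling1 (suc (2 ℕ.^ m ℕ.* 2)) (suc (j ℕ.* 2)))) (ℕ.+-identityʳ (h m j))
    (stirling1-val m j 0 (suc (j ℕ.* 2)) refl z≤n 1≤j j≤M
      (subst (Val 0) (sym (prod-monic (λ _ → pow2 m) (suc (j ℕ.* 2)))) (Val-pow2 0)))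

  stirling1-val-even : ∀ m j → 1 ℕ.≤ j → j ℕ.≤ 2 ℕ.^ m → Val (h m j ℕ.+ m) (+ stirling1 (suc (2 ℕ.^ m ℕ.* 2)) (j ℕ.* 2))
  stirling1-val-even m j 1≤j j≤M = subst (λ e → Val (h m j ℕ.+ e) (+ stirling1 (suc (2 ℕ.^ m ℕ.* 2)) (j ℕ.* 2))) (ℕ.+-identityʳ m)
    (stirling1-val m j 1 (j ℕ.* 2) refl ℕ.≤-refl 1≤j j≤M
      (subst₂ Val (sym (ℕ.+-identityʳ m)) (sym (Z-subleading (pow2 m) (j ℕ.* 2))) (Val-* {0} odd (Val-pow2 m))))
    where
    odd : Val 0 (+ suc (j ℕ.* 2))
    odd = + j , trans (cong (λ x → 1ℤ + x) (trans (ℤ.pos-* j 2) (ℤ.*-comm (+ j) (+ 2)))) (sym (ℤ.*-identityˡ _))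

  -- Descent from row 2^n + 1 to row 2^n

  module _ (m : ℕ) where
    private
      M = 2 ℕ.^ m
      N = M ℕ.* 2
      P R : ℕ → ℤ
      P k = + stirling1 N k
      R k = + stirling1 (suc N) k

    -- In P_k = R_(k+1) - N P_(k+1) the factor N = 2^(m+1) makes the last term divisible by
    -- 2^(m+1+f), hence by 2^(e+1).
    P-from-R : ∀ {e f} k → Val e (R (suc k)) → pow2 f ∣ P (suc k) → e ℕ.≤ m ℕ.+ f → Val e (P k)
    P-from-R {e} {f} k vR d e≤m+f = Val-resp-∣ vR (∣-via difference
      (∣m⇒∣-m (∣-trans (pow2-∣ (s≤s e≤m+f)) (pow2-∣-* (suc m) f N-∣ d))))
      where
      N-∣ : pow2 (suc m) ∣ + N
      N-∣ = ∣-via (cong +_ (ℕ.*-comm M 2)) ∣-refl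
      cancel : ∀ x y → y - (x + y) ≡ - x
      cancel = solve-∀
      difference : P k - R (suc k) ≡ - (+ N * P (suc k))
      difference = trans (cancel (+ (N ℕ.* stirling1 N (suc k))) (P k)) (cong -_ (ℤ.pos-* N (stirling1 N (suc k))))

    -- Downward induction, by recursion on d = M - (j + 1): P_(2j+3) gives P_(2j+2), which gives
    -- P_(2j+1). The first passage rests on `drop`; the second meets the bound of `P-from-R` with
    -- equality.
    P-val : ∀ d j → suc j ℕ.+ d ≡ M →
            Val (h m (suc j)) (P (suc j ℕ.* 2)) × Val (h m (suc j) ℕ.+ m) (P (suc (j ℕ.* 2)))
    P-val d j eq = even , P-from-R (suc (j ℕ.* 2)) (stirling1-val-even m (suc j) (s≤s z≤n) j<M)
                            (Val⇒∣ even ℕ.≤-refl) (ℕ.≤-reflexive (ℕ.+-comm (h m (suc j)) m))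
      where
      j<M : suc j ℕ.≤ M
      j<M = subst (suc j ℕ.≤_) eq (ℕ.m≤m+n (suc j) d)
      next : ∀ d → suc j ℕ.+ d ≡ M → ∃[ f ] pow2 f ∣ P (suc (suc j ℕ.* 2)) × h m (suc j) ℕ.≤ m ℕ.+ f
      -- At the top P_(2M+1) = 0 is divisible by every power of 2, and f = h_M is large enough.
      next zero    eq = h m (suc j) , ∣-via P≡0 (_ ∣0) , ℕ.m≤n+m _ m
        where
        P≡0 : P (suc (suc j ℕ.* 2)) ≡ 0ℤ
        P≡0 = trans (stirling1≡rising N _) (prod-degree _ (s≤s (ℕ.≤-reflexive
                (cong (ℕ._* 2) (trans (sym eq) (ℕ.+-identityʳ (suc j)))))))
      next (suc d) eq = h m (suc (suc j)) ℕ.+ m , Val⇒∣ (proj₂ (P-val d (suc j) eq′)) ℕ.≤-refl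
                      , ℕ.≤-trans (ℕ.<⇒≤ (Profile.drop (profile m) (suc j) (s≤s z≤n) j+1<M))
                          (ℕ.≤-reflexive (regroup m (h m (suc (suc j)))))
        where
        eq′ : suc (suc j) ℕ.+ d ≡ M
        eq′ = trans (sym (ℕ.+-suc (suc j) d)) eq
        j+1<M : suc j ℕ.< M
        j+1<M = subst (suc (suc j) ℕ.≤_) eq′ (ℕ.m≤m+n (suc (suc j)) d)
        regroup : ∀ m x → m ℕ.+ m ℕ.+ x ≡ m ℕ.+ (x ℕ.+ m)
        regroup = ℕ-solver.solve-∀
      even : Val (h m (suc j)) (P (suc j ℕ.* 2))
      even = let _ , d∣ , bound = next d eq in
        P-from-R (suc j ℕ.* 2) (stirling1-val-odd m (suc j) (s≤s z≤n) j<M) d∣ bound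

  parity : ∀ k → (∃[ j ] k ≡ j ℕ.* 2) ⊎ (∃[ j ] k ≡ suc (j ℕ.* 2))
  parity zero = inj₁ (0 , refl)
  parity (suc k) with parity k
  ... | inj₁ (j , refl) = inj₂ (j , refl)
  ... | inj₂ (j , refl) = inj₁ (suc j , refl)

  common-val : ∀ m k → 1 ℕ.≤ k → k ℕ.≤ 2 ℕ.^ m ℕ.* 2 →
    ∃[ e ] Val e (+ stirling1 (2 ℕ.^ m ℕ.* 2) k) × Val e (+ stirling1 (suc (2 ℕ.^ m ℕ.* 2)) (suc k))
  common-val m k 1≤k k≤2M with parity k
  ... | inj₁ (suc j , refl) = h m (suc j) , proj₁ (P-val m _ j (proj₂ gap)) , stirling1-val-odd m (suc j) (s≤s z≤n) j<M
    where
    j<M : suc j ℕ.≤ 2 ℕ.^ m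
    j<M = ℕ.*-cancelʳ-≤ (suc j) (2 ℕ.^ m) 2 k≤2M
    gap = ℕ.m≤n⇒∃[o]m+o≡n j<M
  ... | inj₂ (j , refl) = h m (suc j) ℕ.+ m , proj₂ (P-val m _ j (proj₂ gap)) , stirling1-val-even m (suc j) (s≤s z≤n) j<M
    where
    j<M : suc j ℕ.≤ 2 ℕ.^ m
    j<M = ℕ.*-cancelʳ-< 2 j (2 ℕ.^ m) k≤2M
    gap = ℕ.m≤n⇒∃[o]m+o≡n j<M

  v₂-stirling1 : ∀ m k → 1 ℕ.≤ k → k ℕ.≤ 2 ℕ.^ suc m →
                 v₂ (stirling1 (2 ℕ.^ suc m ℕ.+ 1) (k ℕ.+ 1)) ≡ v₂ (stirling1 (2 ℕ.^ suc m) k)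
  v₂-stirling1 m k 1≤k k≤
    rewrite ℕ.+-comm (2 ℕ.^ suc m) 1 | ℕ.+-comm k 1 | ℕ.*-comm 2 (2 ℕ.^ m) =
    let _ , vP , vR = common-val m k 1≤k k≤ in trans (v₂-Val vR) (sym (v₂-Val vP))

open import Data.Nat using (ℕ; suc; _+_; _^_; _≤_)
open import Relation.Binary.PropositionalEquality using (_≡_)

theorem1p2 : ∀ (n k : ℕ) → 1 ≤ n → 1 ≤ k → k ≤ 2 ^ n →
    v₂ (stirling1 (2 ^ n + 1) (k + 1)) ≡ v₂ (stirling1 (2 ^ n) k)
theorem1p2 (suc m) k _ 1≤k k≤2^n = StirlingValuation.v₂-stirling1 m k 1≤k k≤2^n
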